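{- For all positive integers $n$ and non-negative integers $k$, with $n_1$ denoting a non-negative integer and $Q_m:=\dfrac{y^{(k+1)m}-x^{(k+1)m}}{y^{k+1}-x^{k+1}}$ (a polynomial in $x,y$), $$\det_{0\le i,j\le n-1}\Big(\sum_{l\ge0}\mathcal P^+_{i+j+1}(k,l)\Big)= \begin{cases} (-1)^{n_1\binom{k+1}2}(xy)^{(k+1)^2\binom{n_1+1}2-n}\big(Q_{n_1+1}+(-1)^kQ_{n_1}\big), & \text{if } n=(k+1)n_1,\\ (-1)^{n_1\binom{k+1}2}(xy)^{(k+1)^2\binom{n_1+1}2}(1+x)(1+y)\,Q_{n_1+1}, & \text{if } n=(k+1)n_1+1,\\ (-1)^{(n_1+1)\binom{k+1}2+k}(xy)^{(k+1)^2\binom{n_1+1}2+(k^2-1)(n_1+1)}(1+x)(1+y)\,Q_{n_1+1}, & \text{if } n=(k+1)n_1+k,\\ 0, & \text{if } n\not\equiv 0,1,k \pmod{k+1}. \end{cases}$$ For $k=0$ only the first case applies, and for $k=1$ only the first two cases apply.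
   Context: Three-step paths consist of up-steps $(1,1)$, level steps $(1,0)$ and down-steps $(1,-1)$. Weights: $w((1,1))=1$, $w((1,0))=x+y$, $w((1,-1))=xy$, and the weight $w(P)$ of a path is the product of the weights of its steps. $\mathcal P_n(k,l)=\sum_P w(P)$ over all three-step paths from $(0,k)$ to $(n,l)$; $\mathcal P^+_n(k,l)$ is the same sum restricted to paths that never run below the $x$-axis. For fixed $n,k$ the sum $\sum_{l\ge0}\mathcal P^+_n(k,l)$ is finite. These are polynomials in the indeterminates $x,y$. -}

module Defs where

open import Level using (Level)
open import Algebra.Bundles using (CommutativeRing)
open import Data.Fin.Base using (Fin; zero; suc; toℕ; punchIn)
open import Data.Integer.Base as ℤ using (ℤ; +_; 0ℤ; 1ℤ; -1ℤ)
import Data.Integer.Properties as ℤ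
open import Data.List.Base using (List; []; _∷_; map; filter; foldr; cartesianProductWith)
open import Data.List.Membership.Propositional using (_∈_)
open import Data.List.Membership.Propositional.Properties using (∈-cartesianProductWith⁺)
open import Data.List.Properties using (filter-none)
open import Data.List.Relation.Unary.All as ListAll using ()
open import Data.List.Relation.Unary.Any using (here; there)
open import Data.List.Relation.Unary.AllPairs using ([]; _∷_)
open import Data.List.Relation.Unary.Unique.Propositional using (Unique)
open import Data.List.Relation.Unary.Unique.Propositional.Properties using (cartesianProductWith⁺)
open import Data.Nat.Base as ℕ using (ℕ; zero; suc; s≤s; z≤n)
open import Data.Nat.Combinatorics using (_C_; nC1≡n; nCk+nC[k+1]≡[n+1]C[k+1])
open import Data.Nat.DivMod using (_%_)
import Data.Nat.Properties as ℕ
open import Data.Product.Base using (_×_; _,_)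
open import Data.Vec.Base as Vec using (Vec; []; _∷_)
open import Data.Vec.Properties using (∷-injective)
open import Data.Vec.Relation.Unary.All using (All; all?)
open import Relation.Nullary using (Dec; ¬_)
open import Relation.Nullary.Decidable using (_×-dec_)
open import Relation.Binary.PropositionalEquality as ≡ using (_≡_)

private variable
  c ℓ : Level

------------------------------------------------------------------------
-- Univariate polynomials over a commutative ring

-- A polynomial is its list of coefficients, constant term first; lists that
-- differ by trailing zeros denote the same polynomial.

module Polynomial (R : CommutativeRing c ℓ) where

  open CommutativeRing R
  open import Algebra.Properties.Ring ring using (-0#≈0#)
  open import Algebra.Properties.CommutativeSemigroup +-commutativeSemigroup
    using (interchange)

  Poly : Set c
  Poly = List Carrier

  coeff : Poly → ℕ → Carrier
  coeff []      _       = 0#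
  coeff (a ∷ p) zero    = a
  coeff (a ∷ p) (suc i) = coeff p i

  infix 4 _≈ₚ_

  record _≈ₚ_ (p q : Poly) : Set ℓ where
    constructor mk≈
    field coeff-≈ : ∀ i → coeff p i ≈ coeff q i

  open _≈ₚ_ public

  infixl 6 _+ₚ_
  infixl 7 _*ₚ_ _·ₚ_
  infix  8 -ₚ_

  _+ₚ_ : Poly → Poly → Poly
  []      +ₚ q       = q
  (a ∷ p) +ₚ []      = a ∷ p
  (a ∷ p) +ₚ (b ∷ q) = (a + b) ∷ (p +ₚ q)

  -ₚ_ : Poly → Poly
  -ₚ_ = map (-_)

  _·ₚ_ : Carrier → Poly → Poly
  a ·ₚ p = map (a *_) p

  -- (a + t p) q = a q + t (p q), where t is the indeterminate.
  _*ₚ_ : Poly → Poly → Poly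
  []      *ₚ q = []
  (a ∷ p) *ₚ q = a ·ₚ q +ₚ (0# ∷ p *ₚ q)

  const : Carrier → Poly
  const a = a ∷ []

  indeterminate : Poly
  indeterminate = 0# ∷ 1# ∷ []

  private

    ≈ₚ-refl : ∀ {p} → p ≈ₚ p
    ≈ₚ-refl = mk≈ λ _ → refl

    ≈ₚ-sym : ∀ {p q} → p ≈ₚ q → q ≈ₚ p
    ≈ₚ-sym e = mk≈ λ i → sym (coeff-≈ e i)

    ≈ₚ-trans : ∀ {p q r} → p ≈ₚ q → q ≈ₚ r → p ≈ₚ r
    ≈ₚ-trans e f = mk≈ λ i → trans (coeff-≈ e i) (coeff-≈ f i)

    ∷-cong : ∀ {a b p q} → a ≈ b → p ≈ₚ q → a ∷ p ≈ₚ b ∷ q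
    ∷-cong a≈b p≈q = mk≈ λ where
      zero    → a≈b
      (suc i) → coeff-≈ p≈q i

    0∷[]≈[] : 0# ∷ [] ≈ₚ []
    0∷[]≈[] = mk≈ λ where
      zero    → refl
      (suc i) → refl

  coeff-+ : ∀ p q i → coeff (p +ₚ q) i ≈ coeff p i + coeff q i
  coeff-+ []      q       i       = sym (+-identityˡ _)
  coeff-+ (a ∷ p) []      i       = sym (+-identityʳ _)
  coeff-+ (a ∷ p) (b ∷ q) zero    = refl
  coeff-+ (a ∷ p) (b ∷ q) (suc i) = coeff-+ p q i

  coeff-neg : ∀ p i → coeff (-ₚ p) i ≈ - coeff p i
  coeff-neg []      i       = sym -0#≈0#
  coeff-neg (a ∷ p) zero    = refl
  coeff-neg (a ∷ p) (suc i) = coeff-neg p i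

  coeff-· : ∀ a p i → coeff (a ·ₚ p) i ≈ a * coeff p i
  coeff-· a []      i       = sym (zeroʳ a)
  coeff-· a (b ∷ p) zero    = refl
  coeff-· a (b ∷ p) (suc i) = coeff-· a p i

  private

    +ₚ-cong : ∀ {p p′ q q′} → p ≈ₚ p′ → q ≈ₚ q′ → p +ₚ q ≈ₚ p′ +ₚ q′
    +ₚ-cong {p} {p′} {q} {q′} e f = mk≈ λ i →
      trans (coeff-+ p q i) (trans (+-cong (coeff-≈ e i) (coeff-≈ f i)) (sym (coeff-+ p′ q′ i)))

    -ₚ-cong : ∀ {p q} → p ≈ₚ q → -ₚ p ≈ₚ -ₚ q
    -ₚ-cong {p} {q} e = mk≈ λ i →
      trans (coeff-neg p i) (trans (-‿cong (coeff-≈ e i)) (sym (coeff-neg q i)))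

    ·ₚ-cong : ∀ a {p q} → p ≈ₚ q → a ·ₚ p ≈ₚ a ·ₚ q
    ·ₚ-cong a {p} {q} e = mk≈ λ i →
      trans (coeff-· a p i) (trans (*-congˡ (coeff-≈ e i)) (sym (coeff-· a q i)))

    +ₚ-assoc : ∀ p q r → (p +ₚ q) +ₚ r ≈ₚ p +ₚ (q +ₚ r)
    +ₚ-assoc p q r = mk≈ λ i →
      trans (coeff-+ (p +ₚ q) r i) (trans (+-congʳ (coeff-+ p q i))
        (trans (+-assoc _ _ _)
          (sym (trans (coeff-+ p (q +ₚ r) i) (+-congˡ (coeff-+ q r i))))))

    +ₚ-comm : ∀ p q → p +ₚ q ≈ₚ q +ₚ p
    +ₚ-comm p q = mk≈ λ i →
      trans (coeff-+ p q i) (trans (+-comm _ _) (sym (coeff-+ q p i)))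

    +ₚ-identityʳ : ∀ p → p +ₚ [] ≈ₚ p
    +ₚ-identityʳ p = +ₚ-comm p []

    -ₚ-inverseˡ : ∀ p → -ₚ p +ₚ p ≈ₚ []
    -ₚ-inverseˡ p = mk≈ λ i →
      trans (coeff-+ (-ₚ p) p i) (trans (+-congʳ (coeff-neg p i)) (-‿inverseˡ _))

    -ₚ-inverseʳ : ∀ p → p +ₚ -ₚ p ≈ₚ []
    -ₚ-inverseʳ p = ≈ₚ-trans (+ₚ-comm p (-ₚ p)) (-ₚ-inverseˡ p)

    +ₚ-interchange : ∀ p q r s → (p +ₚ q) +ₚ (r +ₚ s) ≈ₚ (p +ₚ r) +ₚ (q +ₚ s)
    +ₚ-interchange p q r s = mk≈ λ i →
      trans (coeff-+ (p +ₚ q) (r +ₚ s) i)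
        (trans (+-cong (coeff-+ p q i) (coeff-+ r s i))
          (trans (interchange _ _ _ _)
            (sym (trans (coeff-+ (p +ₚ r) (q +ₚ s) i)
              (+-cong (coeff-+ p r i) (coeff-+ q s i))))))

    +ₚ-swap : ∀ p q r → p +ₚ (q +ₚ r) ≈ₚ q +ₚ (p +ₚ r)
    +ₚ-swap p q r = ≈ₚ-trans (≈ₚ-sym (+ₚ-assoc p q r))
      (≈ₚ-trans (+ₚ-cong (+ₚ-comm p q) ≈ₚ-refl) (+ₚ-assoc q p r))

    ·ₚ-distrib : ∀ a p q → a ·ₚ (p +ₚ q) ≈ₚ a ·ₚ p +ₚ a ·ₚ q
    ·ₚ-distrib a p q = mk≈ λ i →
      trans (coeff-· a (p +ₚ q) i) (trans (*-congˡ (coeff-+ p q i))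
        (trans (distribˡ _ _ _)
          (sym (trans (coeff-+ (a ·ₚ p) (a ·ₚ q) i)
            (+-cong (coeff-· a p i) (coeff-· a q i))))))

    ·ₚ-assoc : ∀ a b p → a ·ₚ (b ·ₚ p) ≈ₚ (a * b) ·ₚ p
    ·ₚ-assoc a b p = mk≈ λ i →
      trans (coeff-· a (b ·ₚ p) i) (trans (*-congˡ (coeff-· b p i))
        (trans (sym (*-assoc _ _ _)) (sym (coeff-· (a * b) p i))))

    1·ₚ : ∀ p → 1# ·ₚ p ≈ₚ p
    1·ₚ p = mk≈ λ i → trans (coeff-· 1# p i) (*-identityˡ _)

    0·ₚ : ∀ p → 0# ·ₚ p ≈ₚ []
    0·ₚ p = mk≈ λ i → trans (coeff-· 0# p i) (zeroˡ _)

    0∷-+ : ∀ p q → 0# ∷ (p +ₚ q) ≈ₚ (0# ∷ p) +ₚ (0# ∷ q)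
    0∷-+ p q = ∷-cong (sym (+-identityˡ 0#)) ≈ₚ-refl

    *ₚ-congˡ : ∀ p {q r} → q ≈ₚ r → p *ₚ q ≈ₚ p *ₚ r
    *ₚ-congˡ []      e = ≈ₚ-refl
    *ₚ-congˡ (a ∷ p) e = +ₚ-cong (·ₚ-cong a e) (∷-cong refl (*ₚ-congˡ p e))

    *ₚ-zeroʳ : ∀ p → p *ₚ [] ≈ₚ []
    *ₚ-zeroʳ []      = ≈ₚ-refl
    *ₚ-zeroʳ (a ∷ p) = ≈ₚ-trans (∷-cong refl (*ₚ-zeroʳ p)) 0∷[]≈[]

    *ₚ-∷ : ∀ p b q → p *ₚ (b ∷ q) ≈ₚ b ·ₚ p +ₚ (0# ∷ p *ₚ q)
    *ₚ-∷ []      b q = ≈ₚ-sym 0∷[]≈[]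
    *ₚ-∷ (a ∷ p) b q = ∷-cong (+-congʳ (*-comm a b))
      (≈ₚ-trans (+ₚ-cong ≈ₚ-refl (*ₚ-∷ p b q)) (+ₚ-swap (a ·ₚ q) (b ·ₚ p) (0# ∷ p *ₚ q)))

    *ₚ-comm : ∀ p q → p *ₚ q ≈ₚ q *ₚ p
    *ₚ-comm []      q = ≈ₚ-sym (*ₚ-zeroʳ q)
    *ₚ-comm (a ∷ p) q = ≈ₚ-trans (+ₚ-cong ≈ₚ-refl (∷-cong refl (*ₚ-comm p q)))
      (≈ₚ-sym (*ₚ-∷ q a p))

    *ₚ-cong : ∀ {p p′ q q′} → p ≈ₚ p′ → q ≈ₚ q′ → p *ₚ q ≈ₚ p′ *ₚ q′
    *ₚ-cong {p} {p′} {q} {q′} e f = ≈ₚ-trans (*ₚ-congˡ p f)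
      (≈ₚ-trans (*ₚ-comm p q′) (≈ₚ-trans (*ₚ-congˡ q′ e) (*ₚ-comm q′ p′)))

    *ₚ-distribˡ : ∀ p q r → p *ₚ (q +ₚ r) ≈ₚ p *ₚ q +ₚ p *ₚ r
    *ₚ-distribˡ []      q r = ≈ₚ-refl
    *ₚ-distribˡ (a ∷ p) q r = ≈ₚ-trans
      (+ₚ-cong (·ₚ-distrib a q r)
        (≈ₚ-trans (∷-cong refl (*ₚ-distribˡ p q r)) (0∷-+ (p *ₚ q) (p *ₚ r))))
      (+ₚ-interchange (a ·ₚ q) (a ·ₚ r) (0# ∷ p *ₚ q) (0# ∷ p *ₚ r))

    *ₚ-distribʳ : ∀ p q r → (q +ₚ r) *ₚ p ≈ₚ q *ₚ p +ₚ r *ₚ p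
    *ₚ-distribʳ p q r = ≈ₚ-trans (*ₚ-comm (q +ₚ r) p)
      (≈ₚ-trans (*ₚ-distribˡ p q r) (+ₚ-cong (*ₚ-comm p q) (*ₚ-comm p r)))

    ·ₚ-*ₚ : ∀ a p q → (a ·ₚ p) *ₚ q ≈ₚ a ·ₚ (p *ₚ q)
    ·ₚ-*ₚ a []      q = ≈ₚ-refl
    ·ₚ-*ₚ a (b ∷ p) q = ≈ₚ-trans
      (+ₚ-cong (≈ₚ-sym (·ₚ-assoc a b q)) (∷-cong (sym (zeroʳ a)) (·ₚ-*ₚ a p q)))
      (≈ₚ-sym (·ₚ-distrib a (b ·ₚ q) (0# ∷ p *ₚ q)))

    *ₚ-assoc : ∀ p q r → (p *ₚ q) *ₚ r ≈ₚ p *ₚ (q *ₚ r)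
    *ₚ-assoc []      q r = ≈ₚ-refl
    *ₚ-assoc (a ∷ p) q r = ≈ₚ-trans (*ₚ-distribʳ r (a ·ₚ q) (0# ∷ p *ₚ q))
      (+ₚ-cong (·ₚ-*ₚ a q r)
        (≈ₚ-trans (+ₚ-cong (0·ₚ r) ≈ₚ-refl) (∷-cong refl (*ₚ-assoc p q r))))

    *ₚ-identityˡ : ∀ p → const 1# *ₚ p ≈ₚ p
    *ₚ-identityˡ p = ≈ₚ-trans (+ₚ-cong (1·ₚ p) 0∷[]≈[]) (+ₚ-identityʳ p)

    *ₚ-identityʳ : ∀ p → p *ₚ const 1# ≈ₚ p
    *ₚ-identityʳ p = ≈ₚ-trans (*ₚ-comm p (const 1#)) (*ₚ-identityˡ p)

  polynomialRing : CommutativeRing c ℓ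
  polynomialRing = record
    { Carrier = Poly
    ; _≈_     = _≈ₚ_
    ; _+_     = _+ₚ_
    ; _*_     = _*ₚ_
    ; -_      = -ₚ_
    ; 0#      = []
    ; 1#      = const 1#
    ; isCommutativeRing = record
      { isRing = record
        { +-isAbelianGroup = record
          { isGroup = record
            { isMonoid = record
              { isSemigroup = record
                { isMagma = record
                  { isEquivalence = record { refl = ≈ₚ-refl ; sym = ≈ₚ-sym ; trans = ≈ₚ-trans }
                  ; ∙-cong = +ₚ-cong
                  }
                ; assoc = +ₚ-assoc
                }
              ; identity = (λ _ → ≈ₚ-refl) , +ₚ-identityʳ
              }
            ; inverse = -ₚ-inverseˡ , -ₚ-inverseʳ
            ; ⁻¹-cong = -ₚ-cong
            }
          ; comm = +ₚ-comm
          }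
        ; *-cong = *ₚ-cong
        ; *-assoc = *ₚ-assoc
        ; *-identity = *ₚ-identityˡ , *ₚ-identityʳ
        ; distrib = *ₚ-distribˡ , *ₚ-distribʳ
        }
      ; *-comm = *ₚ-comm
      }
    }

module ℤ[x]    = Polynomial ℤ.+-*-commutativeRing
module ℤ[x][y] = Polynomial ℤ[x].polynomialRing

ℤ[x,y] : CommutativeRing _ _
ℤ[x,y] = ℤ[x][y].polynomialRing

x y : CommutativeRing.Carrier ℤ[x,y]
x = ℤ[x][y].const ℤ[x].indeterminate
y = ℤ[x][y].indeterminate

------------------------------------------------------------------------
-- Determinants

module Determinant (R : CommutativeRing c ℓ) where

  open CommutativeRing R hiding (zero)
  open import Algebra.Properties.Semiring.Exp semiring using (_^_)
  open import Algebra.Properties.CommutativeMonoid.Sum +-commutativeMonoid using (sum-syntax)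

  Matrix : ℕ → Set c
  Matrix n = Fin n → Fin n → Carrier

  -- Laplace expansion along the first row.
  det : ∀ {n} → Matrix n → Carrier
  det {zero}  A = 1#
  det {suc n} A =
    ∑[ j < suc n ] ((- 1#) ^ toℕ j * (A zero j * det (λ i l → A (suc i) (punchIn j l))))

------------------------------------------------------------------------
-- Three-step paths

data Step : Set where
  up level down : Step

-- The step itself is the vector (1 , rise s), so a path from (0 , k) to
-- (n , l) is a sequence of n steps leading from height k to height l.
rise : Step → ℤ
rise up    = 1ℤ
rise level = 0ℤ
rise down  = -1ℤ

Path : ℕ → Set
Path = Vec Step

endHeight : ∀ {n} → ℤ → Path n → ℤ
endHeight h []      = h
endHeight h (s ∷ P) = endHeight (h ℤ.+ rise s) P

heights : ∀ {n} → ℤ → Path n → Vec ℤ (suc n)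
heights h []      = h ∷ []
heights h (s ∷ P) = h ∷ heights (h ℤ.+ rise s) P

-- Paths are piecewise linear, so it suffices to look at the lattice points.
NeverBelowAxis : ∀ {n} → ℤ → Path n → Set
NeverBelowAxis h P = All (0ℤ ℤ.≤_) (heights h P)

_IsPath⁺From_To_ : ∀ {n} → Path n → ℕ → ℕ → Set
P IsPath⁺From k To l = endHeight (+ k) P ≡ + l × NeverBelowAxis (+ k) P

isPath⁺? : ∀ {n} (k l : ℕ) (P : Path n) → Dec (P IsPath⁺From k To l)
isPath⁺? k l P = (endHeight (+ k) P ℤ.≟ + l) ×-dec all? (0ℤ ℤ.≤?_) (heights (+ k) P)

steps : List Step
steps = up ∷ level ∷ down ∷ []

allPaths : ∀ n → List (Path n)
allPaths zero    = [] ∷ []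
allPaths (suc n) = cartesianProductWith _∷_ steps (allPaths n)

allPaths-complete : ∀ {n} (P : Path n) → P ∈ allPaths n
allPaths-complete []      = here ≡.refl
allPaths-complete (s ∷ P) = ∈-cartesianProductWith⁺ _∷_ (∈-steps s) (allPaths-complete P)
  where
  ∈-steps : ∀ s → s ∈ steps
  ∈-steps up    = here ≡.refl
  ∈-steps level = there (here ≡.refl)
  ∈-steps down  = there (there (here ≡.refl))

allPaths-unique : ∀ n → Unique (allPaths n)
allPaths-unique zero    = ListAll.[] ∷ []
allPaths-unique (suc n) = cartesianProductWith⁺ _∷_ ∷-injective steps-unique (allPaths-unique n)
  where
  steps-unique : Unique steps
  steps-unique = ((λ ()) ListAll.∷ (λ ()) ListAll.∷ ListAll.[])
               ∷ ((λ ()) ListAll.∷ ListAll.[])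
               ∷ ListAll.[] ∷ []

module PathSums (R : CommutativeRing c ℓ) (x y : CommutativeRing.Carrier R) where

  open CommutativeRing R
  open import Algebra.Properties.CommutativeMonoid.Sum +-commutativeMonoid using (sum-syntax)

  stepWeight : Step → Carrier
  stepWeight up    = 1#
  stepWeight level = x + y
  stepWeight down  = x * y

  weight : ∀ {n} → Path n → Carrier
  weight []      = 1#
  weight (s ∷ P) = stepWeight s * weight P

  totalWeight : ∀ {n} → List (Path n) → Carrier
  totalWeight Ps = foldr _+_ 0# (map weight Ps)

  𝒫⁺ : (n k l : ℕ) → Carrier
  𝒫⁺ n k l = totalWeight (filter (isPath⁺? k l) (allPaths n))

  -- The sum over all l ≥ 0: by 𝒫⁺-vanishes below, the terms with l > n + k
  -- are zero.
  ∑𝒫⁺ : (n k : ℕ) → Carrier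
  ∑𝒫⁺ n k = ∑[ l < suc (n ℕ.+ k) ] 𝒫⁺ n k (toℕ l)

  private
    rise≤1 : ∀ s → rise s ℤ.≤ 1ℤ
    rise≤1 up    = ℤ.+≤+ (s≤s z≤n)
    rise≤1 level = ℤ.+≤+ z≤n
    rise≤1 down  = ℤ.-≤+

    endHeight-≤ : ∀ {n} h (P : Path n) → endHeight h P ℤ.≤ + n ℤ.+ h
    endHeight-≤ h [] = ℤ.≤-reflexive (≡.sym (ℤ.+-identityˡ h))
    endHeight-≤ {suc n} h (s ∷ P) = ℤ.≤-trans (endHeight-≤ (h ℤ.+ rise s) P)
      (ℤ.≤-trans (ℤ.+-monoʳ-≤ (+ n) (ℤ.+-monoʳ-≤ h (rise≤1 s)))
        (ℤ.≤-reflexive lemma))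
      where
      lemma : + n ℤ.+ (h ℤ.+ 1ℤ) ≡ + suc n ℤ.+ h
      lemma = ≡.trans (≡.cong (λ t → + n ℤ.+ t) (ℤ.+-comm h 1ℤ))
        (≡.trans (≡.sym (ℤ.+-assoc (+ n) 1ℤ h))
          (≡.cong (ℤ._+ h) (≡.cong +_ (ℕ.+-comm n 1))))

  𝒫⁺-vanishes : ∀ n k l → n ℕ.+ k ℕ.< l → 𝒫⁺ n k l ≡ 0#
  𝒫⁺-vanishes n k l n+k<l = ≡.cong totalWeight
    (filter-none (isPath⁺? k l) (ListAll.universal noPath (allPaths n)))
    where
    noPath : (P : Path n) → ¬ (P IsPath⁺From k To l)
    noPath P (end≡l , _) = ℕ.<⇒≱ n+k<l
      (ℤ.drop‿+≤+ (≡.subst (ℤ._≤ + (n ℕ.+ k)) end≡l (endHeight-≤ (+ k) P)))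

------------------------------------------------------------------------
-- The quotients Q_m

module Quotient (R : CommutativeRing c ℓ) (x y : CommutativeRing.Carrier R) where

  open CommutativeRing R
  open import Algebra.Properties.Semiring.Exp semiring using (_^_; ^-assocʳ)
  open import Algebra.Properties.Ring ring using (x[y-z]≈xy-xz)
  open import Relation.Binary.Reasoning.Setoid setoid

  -- Q m = (y^((k+1)m) - x^((k+1)m)) / (y^(k+1) - x^(k+1)).  In ℤ[x,y], an
  -- integral domain, this determines Q.
  IsQ : ℕ → (ℕ → Carrier) → Set ℓ
  IsQ k Q = ∀ m →
    Q m * (y ^ suc k - x ^ suc k) ≈ y ^ (suc k ℕ.* m) - x ^ (suc k ℕ.* m)

  private
    geometric : Carrier → Carrier → ℕ → Carrier
    geometric u v zero    = 0#
    geometric u v (suc m) = v ^ m + u * geometric u v m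

    telescope : ∀ a b c → (a - b) + (b - c) ≈ a - c
    telescope a b c = begin
      (a - b) + (b - c)      ≈⟨ +-assoc a (- b) (b - c) ⟩
      a + (- b + (b - c))    ≈⟨ +-congˡ (+-assoc (- b) b (- c)) ⟨
      a + ((- b + b) - c)    ≈⟨ +-congˡ (+-congʳ (-‿inverseˡ b)) ⟩
      a + (0# - c)           ≈⟨ +-congˡ (+-identityˡ (- c)) ⟩
      a - c                  ∎

    geometric-sum : ∀ u v m → geometric u v m * (v - u) ≈ v ^ m - u ^ m
    geometric-sum u v zero    = trans (zeroˡ _) (sym (-‿inverseʳ 1#))
    geometric-sum u v (suc m) = begin
      (v ^ m + u * g) * (v - u)                      ≈⟨ distribʳ (v - u) (v ^ m) (u * g) ⟩
      v ^ m * (v - u) + u * g * (v - u)              ≈⟨ +-cong (x[y-z]≈xy-xz _ _ _) (*-assoc u g (v - u)) ⟩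
      (v ^ m * v - v ^ m * u) + u * (g * (v - u))    ≈⟨ +-cong (+-cong (*-comm _ _) (-‿cong (*-comm _ _))) (*-congˡ (geometric-sum u v m)) ⟩
      (v * v ^ m - u * v ^ m) + u * (v ^ m - u ^ m)  ≈⟨ +-congˡ (x[y-z]≈xy-xz _ _ _) ⟩
      (v * v ^ m - u * v ^ m) + (u * v ^ m - u * u ^ m) ≈⟨ telescope _ _ _ ⟩
      v * v ^ m - u * u ^ m                          ∎
      where g = geometric u v m

  IsQ-exists : ∀ k → IsQ k (geometric (x ^ suc k) (y ^ suc k))
  IsQ-exists k m = trans (geometric-sum (x ^ suc k) (y ^ suc k) m)
    (+-cong (^-assocʳ y (suc k) m) (-‿cong (^-assocʳ x (suc k) m)))

------------------------------------------------------------------------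
-- Arithmetic

infix 4 _≡_[mod_]

_≡_[mod_] : ℕ → ℕ → (m : ℕ) → .{{ℕ.NonZero m}} → Set
a ≡ b [mod m ] = a % m ≡ b % m

-- The exponent (k+1)²·C(n₁+1,2) − n occurring for n = (k+1)n₁ is non-negative,
-- so truncated subtraction agrees with subtraction there.
exponent-≥0 : ∀ k n₁ → suc k ℕ.* n₁ ℕ.≤ suc k ℕ.^ 2 ℕ.* (suc n₁ C 2)
exponent-≥0 k n₁ = ℕ.*-mono-≤ (ℕ.m≤m*n (suc k) (suc k ℕ.* 1)) n₁≤
  where
  n₁≤ : n₁ ℕ.≤ suc n₁ C 2
  n₁≤ = ≡.subst₂ ℕ._≤_ (nC1≡n n₁) (nCk+nC[k+1]≡[n+1]C[k+1] n₁ 1) (ℕ.m≤m+n (n₁ C 1) (n₁ C 2))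

{-# OPTIONS --safe --termination-depth=2 #-}

-- Let t act on rows as the left shift.  The rows σ l of weights of paths starting
-- at height l − 1 satisfy t σₗ = σₗ₊₁ + (x+y) σₗ + xy σₗ₋₁ with σ₀ = 0, so σₗ₊₁ = uₗ(t) σ₁
-- for Chebyshev-like polynomials uₗ, and with K = k + 1 the determinant has the
-- rows t σ_K, …, tⁿ σ_K.  Put v_b = u_{Kb−1} / u_{K−1}, so that v_b σ_K = σ_{Kb}.
--
-- A path not longer than its starting height never runs below the axis, so the
-- initial part of σₗ is geometric with ratio q = (1+x)(1+y).  Hence the monic polynomial
-- v_{n₁+1} − v_{n₁} (if n = K n₁) or (t − q) v_{n₁+1} (otherwise) annihilates σ_K in the
-- first n columns.  Its leading power of t can therefore be traded for its
-- constant term, which produces the Q's; if t times the polynomial annihilates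
-- σ_K as well, the determinant vanishes.  In the remaining determinant one passes
-- to the rows u_a v_b σ_K (a ≤ k): after reversal of each block of fixed b, which
-- produces the sign, and subtraction of multiples of the geometric row v_b σ_K
-- with the largest b, it is triangular.
module Submission where

open import Defs
open import Algebra.Bundles using (CommutativeRing)
import Algebra.Solver.Ring
open import Algebra.Solver.Ring.AlmostCommutativeRing using (fromCommutativeRing; _-Raw-AlmostCommutative⟶_)
open import Data.Fin.Base using (Fin; zero; suc; toℕ; punchIn)
open import Data.Integer.Base as ℤ using (ℤ; +_; -[1+_])
import Data.Integer.Properties as ℤ
open import Data.List.Base using (List; []; _∷_; _++_; _ʳ++_; filter; length; map; tabulate)
open import Data.List.Properties
  using (++-assoc; ++-identityʳ; filter-++; filter-accept; filter-none; filter-reject; length-++; length-map;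
         length-ʳ++; ʳ++-ʳ++)
open import Data.List.Relation.Unary.All using (universal)
open import Data.List.Relation.Unary.All.Properties using () renaming (map⁺ to All-map⁺)
open import Data.Maybe.Base using (Maybe; just; nothing)
open import Data.Nat.Base as ℕ using (ℕ; zero; suc; s≤s; z≤n)
open import Data.Nat.Combinatorics using (_C_; nC1≡n; nCk+nC[k+1]≡[n+1]C[k+1])
open import Data.Nat.DivMod using (_%_; _/_; m≡m%n+[m/n]*n; m%n<n; m<n⇒m%n≡m)
import Data.Nat.Properties as ℕ
open import Data.Nat.Solver using (module +-*-Solver)
open import Data.Product.Base using (_×_; _,_; proj₁; proj₂)
open import Data.Sign.Base as Sign using (Sign)
open import Data.Sum.Base using (inj₁; inj₂)
open import Data.Vec.Base using ([]; _∷_)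
open import Data.Vec.Relation.Unary.All using ([]; _∷_)
open import Function.Base using (_∘_)
open import Level using (Level; _⊔_)
open import Relation.Binary.PropositionalEquality as ≡ using (_≡_; _≢_)
open import Relation.Nullary using (¬_; contradiction; yes; no)

-- The substitution t = z + x + y + xy/z explains the constants. Formally u_a is (zᵃ⁺¹ -
-- (xy/z)ᵃ⁺¹)/(z - xy/z), so v_b = (Zᵇ - Z′ᵇ)/(Z - Z′) with Z = zᴷ and Z′ = (xy/z)ᴷ, a polynomial
-- given by a recursion of second order. At t = 0 one may take z = -x, when Z and Z′ become (-x)ᴷ
-- and (-y)ᴷ: up to sign the constant term of v_b is Q_b. At z = 1 one gets t = q, the sum of the
-- step weights, and t - q kills geometric rows of ratio q. The obstacle is that all relations
-- between the rows hold only in an initial segment of the columns, and that in a commutative ring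
-- neither division nor a rank argument is at hand. Therefore every row relation is asked for only
-- in the visible columns, and dependence on earlier rows is expressed by vanishing determinants
-- (`Null`). The powers of xy have one combinatorial source: the first path lost from height l is
-- the one with l + 1 down-steps. The determinant is computed with an explicit sequence `G` over any
-- commutative ring; ℤ[x,y] enters only when `G` is identified with the given `Q`.

-- Arithmetic of exponents and signs

[1+n]C2≡n+nC2 : ∀ n → suc n C 2 ≡ n ℕ.+ n C 2
[1+n]C2≡n+nC2 n = ≡.trans (≡.sym (nCk+nC[k+1]≡[n+1]C[k+1] n 1)) (≡.cong (ℕ._+ n C 2) (nC1≡n n))

module ExponentArithmetic where

  open +-*-Solver using (solve; _:+_; _:*_; con; _:=_)

  block-exponent : ∀ K b m t e → K ℕ.* suc b ℕ.* K ℕ.+ (K ℕ.* K ℕ.* (m ℕ.* suc b ℕ.+ t) ℕ.+ e) ≡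
    K ℕ.* K ℕ.* (suc m ℕ.* b ℕ.+ (suc m ℕ.+ t)) ℕ.+ e
  block-exponent = solve 5 (λ K b m t e →
    K :* (con 1 :+ b) :* K :+ (K :* K :* (m :* (con 1 :+ b) :+ t) :+ e) :=
    K :* K :* ((con 1 :+ m) :* b :+ (con 1 :+ m :+ t)) :+ e) ≡.refl

  -- By `[1+n]C2≡n+nC2` the minuend contains K²n₁ = kKn₁ + Kn₁ with K = k + 1, and the second part
  -- is what the truncated subtraction removes.
  multiple-exponent : ∀ k n₁ → suc k ℕ.^ 2 ℕ.* (suc n₁ C 2) ℕ.∸ suc k ℕ.* n₁ ≡
    suc k ℕ.* suc k ℕ.* (n₁ C 2) ℕ.+ k ℕ.* (suc k ℕ.* n₁)
  multiple-exponent k n₁ = ≡.trans (≡.cong (ℕ._∸ suc k ℕ.* n₁)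
      (≡.trans (≡.cong (suc k ℕ.^ 2 ℕ.*_) ([1+n]C2≡n+nC2 n₁))
        (solve 3 (λ k m t → (con 1 :+ k) :* ((con 1 :+ k) :* con 1) :* (m :+ t) :=
          (con 1 :+ k) :* (con 1 :+ k) :* t :+ k :* ((con 1 :+ k) :* m) :+ (con 1 :+ k) :* m) ≡.refl k n₁ (n₁ C 2))))
    (ℕ.m+n∸n≡m _ (suc k ℕ.* n₁))

  square-exponent : ∀ k t → suc k ℕ.^ 2 ℕ.* t ≡ suc k ℕ.* suc k ℕ.* t
  square-exponent k t = ≡.cong (λ e → suc k ℕ.* e ℕ.* t) (ℕ.*-identityʳ (suc k))

  multiple+k-exponent : ∀ g n₁ → (suc g ℕ.^ 2 ℕ.∸ 1) ℕ.* suc n₁ ≡ g ℕ.* (suc (suc g) ℕ.* suc n₁)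
  multiple+k-exponent g n₁ = ≡.trans
    (≡.cong (λ e → (e ℕ.∸ 1) ℕ.* suc n₁)
      (solve 1 (λ g → (con 1 :+ g) :* ((con 1 :+ g) :* con 1) := con 1 :+ g :* (con 2 :+ g)) ≡.refl g))
    (ℕ.*-assoc g (suc (suc g)) (suc n₁))

  -- The right side is 2k plus the exponent contributed by reversing n₁ full blocks and a last block
  -- of k rows, so both exponents give the same sign.
  multiple+k-sign : ∀ k n₁ → suc n₁ ℕ.* (suc k C 2) ℕ.+ k ≡ k ℕ.+ k ℕ.+ (n₁ ℕ.* (suc k C 2) ℕ.+ k C 2)
  multiple+k-sign k n₁ = ≡.trans
    (≡.cong (λ e → e ℕ.+ n₁ ℕ.* (suc k C 2) ℕ.+ k) ([1+n]C2≡n+nC2 k))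
    (solve 3 (λ k t u → k :+ t :+ u :+ k := k :+ k :+ (u :+ t)) ≡.refl k (k C 2) (n₁ ℕ.* (suc k C 2)))

open ExponentArithmetic

-- Solver for ring identities with integer coefficients

module IntegerSolver {c ℓ : Level} (R : CommutativeRing c ℓ) where

  open CommutativeRing R hiding (zero)
  open import Algebra.Properties.Semiring.Mult.TCOptimised semiring
    using (×-homo-+; ×1-homo-*; 1+×) renaming (_×_ to _·_)
  open import Algebra.Properties.Ring ring
  open import Relation.Binary.Reasoning.Setoid setoid

  private
    ⟦_⟧ : ℤ → Carrier
    ⟦ + n ⟧      = n · 1#
    ⟦ -[1+ n ] ⟧ = - (suc n · 1#)

    signed : Sign → Carrier → Carrier
    signed Sign.+ a = a
    signed Sign.- a = - a

    ⟦neg⟧ : ∀ i → ⟦ ℤ.- i ⟧ ≈ - ⟦ i ⟧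
    ⟦neg⟧ (+ zero)   = sym -0#≈0#
    ⟦neg⟧ (+ suc n)  = refl
    ⟦neg⟧ (-[1+ n ]) = sym (-‿involutive _)

    ⟦◃⟧ : ∀ s n → ⟦ s ℤ.◃ n ⟧ ≈ signed s (n · 1#)
    ⟦◃⟧ Sign.+ zero    = refl
    ⟦◃⟧ Sign.- zero    = sym -0#≈0#
    ⟦◃⟧ Sign.+ (suc n) = refl
    ⟦◃⟧ Sign.- (suc n) = refl

    cancel-suc : ∀ a b → (1# + a) - (1# + b) ≈ a - b
    cancel-suc a b = begin
      (1# + a) - (1# + b)       ≈⟨ +-cong (+-comm 1# a) (sym (-‿+-comm 1# b)) ⟩
      (a + 1#) + (- 1# + - b)   ≈⟨ +-assoc a 1# _ ⟩
      a + (1# + (- 1# + - b))   ≈⟨ +-congˡ (+-assoc 1# (- 1#) (- b)) ⟨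
      a + ((1# + - 1#) + - b)   ≈⟨ +-congˡ (+-congʳ (-‿inverseʳ 1#)) ⟩
      a + (0# + - b)            ≈⟨ +-congˡ (+-identityˡ (- b)) ⟩
      a - b                     ∎

    ⟦⊖⟧ : ∀ m n → ⟦ m ℤ.⊖ n ⟧ ≈ m · 1# - n · 1#
    ⟦⊖⟧ m zero = sym (trans (+-congˡ -0#≈0#) (+-identityʳ _))
    ⟦⊖⟧ zero (suc n) = sym (+-identityˡ _)
    ⟦⊖⟧ (suc m) (suc n) = begin
      ⟦ suc m ℤ.⊖ suc n ⟧               ≡⟨ ≡.cong ⟦_⟧ (ℤ.[1+m]⊖[1+n]≡m⊖n m n) ⟩
      ⟦ m ℤ.⊖ n ⟧                       ≈⟨ ⟦⊖⟧ m n ⟩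
      m · 1# - n · 1#                   ≈⟨ cancel-suc _ _ ⟨
      (1# + m · 1#) - (1# + n · 1#)     ≈⟨ +-cong (1+× m 1#) (-‿cong (1+× n 1#)) ⟨
      suc m · 1# - suc n · 1#           ∎

    ⟦+⟧ : ∀ i j → ⟦ i ℤ.+ j ⟧ ≈ ⟦ i ⟧ + ⟦ j ⟧
    ⟦+⟧ (+ m)    (+ n)    = ×-homo-+ 1# m n
    ⟦+⟧ (+ m)    -[1+ n ] = ⟦⊖⟧ m (suc n)
    ⟦+⟧ -[1+ m ] (+ n)    = trans (⟦⊖⟧ n (suc m)) (+-comm _ _)
    ⟦+⟧ -[1+ m ] -[1+ n ] = begin
      - (suc (suc (m ℕ.+ n)) · 1#)        ≡⟨ ≡.cong (λ t → - (suc t · 1#)) (ℕ.+-suc m n) ⟨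
      - ((suc m ℕ.+ suc n) · 1#)          ≈⟨ -‿cong (×-homo-+ 1# (suc m) (suc n)) ⟩
      - (suc m · 1# + suc n · 1#)         ≈⟨ -‿+-comm _ _ ⟨
      - (suc m · 1#) + - (suc n · 1#)     ∎

    ⟦*⟧ : ∀ i j → ⟦ i ℤ.* j ⟧ ≈ ⟦ i ⟧ * ⟦ j ⟧
    ⟦*⟧ (+ m)    (+ n)    = trans (⟦◃⟧ Sign.+ (m ℕ.* n)) (×1-homo-* m n)
    ⟦*⟧ (+ m)    -[1+ n ] = trans (⟦◃⟧ Sign.- (m ℕ.* suc n))
      (trans (-‿cong (×1-homo-* m (suc n))) (-‿distribʳ-* _ _))
    ⟦*⟧ -[1+ m ] (+ n)    = trans (⟦◃⟧ Sign.- (suc m ℕ.* n))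
      (trans (-‿cong (×1-homo-* (suc m) n)) (-‿distribˡ-* _ _))
    ⟦*⟧ -[1+ m ] -[1+ n ] = trans (×1-homo-* (suc m) (suc n))
      (sym (trans (sym (-‿distribˡ-* _ _))
        (trans (-‿cong (sym (-‿distribʳ-* _ _))) (-‿involutive _))))

    morphism : ℤ.+-*-rawRing -Raw-AlmostCommutative⟶ fromCommutativeRing R
    morphism = record
      { ⟦_⟧ = ⟦_⟧ ; +-homo = ⟦+⟧ ; *-homo = ⟦*⟧ ; -‿homo = ⟦neg⟧ ; 0-homo = refl ; 1-homo = refl }

    -- Coefficients are integers because the solver has to recognise equal ones, which cannot be
    -- decided in `R`.
    coeff≟ : ∀ i j → Maybe (⟦ i ⟧ ≈ ⟦ j ⟧)
    coeff≟ i j with i ℤ.≟ j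
    ... | yes i≡j = just (reflexive (≡.cong ⟦_⟧ i≡j))
    ... | no  _   = nothing

  open Algebra.Solver.Ring ℤ.+-*-rawRing (fromCommutativeRing R) morphism coeff≟ public
    using (solve; _:=_; _:+_; _:*_; _:-_; :-_; con)

-- Determinants of lists of rows: multilinearity, alternation, signs

module RowDeterminant {c ℓ : Level} (R : CommutativeRing c ℓ) where

  open CommutativeRing R hiding (zero)
  open import Algebra.Properties.Ring ring
  open import Algebra.Properties.Semiring.Exp semiring using (_^_; ^-homo-*)
  open import Algebra.Properties.Semiring.Sum semiring using (*-distribˡ-sum)
  open import Algebra.Properties.CommutativeMonoid.Sum +-commutativeMonoid using (sum; sum-syntax; sum-cong-≋)
  open import Relation.Binary.Reasoning.Setoid setoid
  open IntegerSolver R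
  open Determinant R using (Matrix; det)

  Row : Set c
  Row = ℕ → Carrier

  -- Δ j n rs is the determinant of the rows rs cut down to the n columns
  -- j, …, j+n−1, by expansion along column j (0 if there are not n rows).
  mutual
    Δ : ℕ → ℕ → List Row → Carrier
    Δ j zero    []      = 1#
    Δ j zero    (_ ∷ _) = 0#
    Δ j (suc n) rs      = expand j n [] rs

    -- `pre` holds the rows already passed over, the last one first, so `pre ʳ++ rs` is the minor
    -- without `r`; the subtraction makes the signs alternate.
    expand : ℕ → ℕ → List Row → List Row → Carrier
    expand j n pre []       = 0#
    expand j n pre (r ∷ rs) = r j * Δ (suc j) n (pre ʳ++ rs) - expand j n (r ∷ pre) rs

  private
    expand-tabulate : ∀ j n {m} pre (g : Fin (suc m) → Row) →
      expand j n pre (tabulate g) ≈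
        ∑[ i < suc m ] ((- 1#) ^ toℕ i * (g i j * Δ (suc j) n (pre ʳ++ tabulate (λ l → g (punchIn i l)))))
    expand-tabulate j n {zero} pre g = +-cong (sym (*-identityˡ _)) -0#≈0#
    expand-tabulate j n {suc m} pre g = +-cong (sym (*-identityˡ _)) (begin
      - expand j n (g zero ∷ pre) (tabulate (λ i → g (suc i)))
        ≈⟨ -‿cong (expand-tabulate j n (g zero ∷ pre) (λ i → g (suc i))) ⟩
      - sum t                  ≈⟨ -1*x≈-x _ ⟨
      - 1# * sum t             ≈⟨ *-distribˡ-sum (- 1#) t ⟩
      sum (λ i → - 1# * t i)   ≈⟨ sum-cong-≋ (λ i → sym (*-assoc (- 1#) ((- 1#) ^ toℕ i) (minor i))) ⟩
      sum (λ i → (- 1#) ^ suc (toℕ i) * minor i) ∎)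
      where
      minor t : Fin (suc m) → Carrier
      minor i = g (suc i) j * Δ (suc j) n ((g zero ∷ pre) ʳ++ tabulate (λ l → g (suc (punchIn i l))))
      t i = (- 1#) ^ toℕ i * minor i

  -- Expansion of A along its first row is expansion of its list of columns
  -- along the first entries.
  det-Δ : ∀ j n (A : Matrix n) (f : Fin n → Row) → (∀ i l → A i l ≈ f l (j ℕ.+ toℕ i)) →
    det A ≈ Δ j n (tabulate f)
  det-Δ j zero    A f A≈f = refl
  det-Δ j (suc n) A f A≈f = sym (trans (expand-tabulate j n [] f) (sum-cong-≋ λ i →
    *-congˡ {(- 1#) ^ toℕ i} (*-cong
      (sym (trans (A≈f zero i) (reflexive (≡.cong (f i) (ℕ.+-identityʳ j)))))
      (sym (det-Δ (suc j) n _ (λ l → f (punchIn i l)) λ r l →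
        trans (A≈f (suc r) (punchIn i l)) (reflexive (≡.cong (f (punchIn i l)) (ℕ.+-suc j (toℕ r)))))))))

  ʳ++-++ : ∀ {A : Set c} (pre : List A) {xs zs} → (pre ʳ++ xs) ++ zs ≡ pre ʳ++ (xs ++ zs)
  ʳ++-++ []        = ≡.refl
  ʳ++-++ (x ∷ pre) = ʳ++-++ pre

  private
    combine : ∀ a b r s t s′ t′ → r * (a * s + b * t) - (a * s′ + b * t′) ≈
      a * (r * s - s′) + b * (r * t - t′)
    combine = solve 7 (λ a b r s t s′ t′ → r :* (a :* s :+ b :* t) :- (a :* s′ :+ b :* t′) :=
      a :* (r :* s :- s′) :+ b :* (r :* t :- t′)) refl

    -- Here `f`, `g`, `h` are prefixes: the varying row has already been passed over, so it occurs
    -- in every minor still to come and never contributes its own entry.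
    expand-linear-pre : ∀ j n {f g h a b} →
      (∀ zs → Δ (suc j) n (f ʳ++ zs) ≈ a * Δ (suc j) n (g ʳ++ zs) + b * Δ (suc j) n (h ʳ++ zs)) →
      ∀ ys → expand j n f ys ≈ a * expand j n g ys + b * expand j n h ys
    expand-linear-pre j n {a = a} {b} hyp [] = sym (trans (+-cong (zeroʳ a) (zeroʳ b)) (+-identityˡ _))
    expand-linear-pre j n hyp (y ∷ ys) = trans
      (+-cong (*-congˡ (hyp ys)) (-‿cong (expand-linear-pre j n (λ zs → hyp (y ∷ zs)) ys)))
      (combine _ _ _ _ _ _ _)

  mutual
    private
      -- In the expansion along a column each term contains the varying row either through its entry
      -- or inside the minor, never both. The relation is asked for only in columns below j + n, as
      -- the rows of path weights satisfy theirs only in an initial segment.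
      Δ-linear-++ : ∀ j n xs {ys f g h a b} → (∀ i → i ℕ.< j ℕ.+ n → f i ≈ a * g i + b * h i) →
        Δ j n (xs ++ f ∷ ys) ≈ a * Δ j n (xs ++ g ∷ ys) + b * Δ j n (xs ++ h ∷ ys)
      Δ-linear-++ j zero []      f≈ = sym (trans (+-cong (zeroʳ _) (zeroʳ _)) (+-identityˡ _))
      Δ-linear-++ j zero (_ ∷ _) f≈ = sym (trans (+-cong (zeroʳ _) (zeroʳ _)) (+-identityˡ _))
      Δ-linear-++ j (suc n) xs f≈ = expand-linear j n [] xs f≈

      expand-linear : ∀ j n pre xs {ys f g h a b} →
        (∀ i → i ℕ.< j ℕ.+ suc n → f i ≈ a * g i + b * h i) →
        expand j n pre (xs ++ f ∷ ys) ≈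
          a * expand j n pre (xs ++ g ∷ ys) + b * expand j n pre (xs ++ h ∷ ys)
      expand-linear j n pre [] {ys} f≈ = trans
        (+-cong (*-congʳ (f≈ j (ℕ.m<m+n j (s≤s z≤n))))
          (-‿cong (expand-linear-pre j n (λ zs → Δ-linear (suc j) n pre
            (λ i i< → f≈ i (≡.subst (i ℕ.<_) (≡.sym (ℕ.+-suc j n)) i<))) ys)))
        (solve 7 (λ a b r s t s′ t′ → (a :* s :+ b :* t) :* r :- (a :* s′ :+ b :* t′) :=
          a :* (s :* r :- s′) :+ b :* (t :* r :- t′)) refl _ _ _ _ _ _ _)
      expand-linear j n pre (x ∷ xs) {ys} {f} {g} {h} {a} {b} f≈ = trans
        (+-cong (*-congˡ minors) (-‿cong (expand-linear j n (x ∷ pre) xs f≈)))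
        (combine _ _ _ _ _ _ _)
        where
        minors : Δ (suc j) n (pre ʳ++ (xs ++ f ∷ ys)) ≈
          a * Δ (suc j) n (pre ʳ++ (xs ++ g ∷ ys)) + b * Δ (suc j) n (pre ʳ++ (xs ++ h ∷ ys))
        minors rewrite ≡.sym (ʳ++-++ pre {xs} {f ∷ ys}) | ≡.sym (ʳ++-++ pre {xs} {g ∷ ys})
          | ≡.sym (ʳ++-++ pre {xs} {h ∷ ys}) =
          Δ-linear-++ (suc j) n (pre ʳ++ xs) (λ i i< → f≈ i (≡.subst (i ℕ.<_) (≡.sym (ℕ.+-suc j n)) i<))

    Δ-linear : ∀ j n pre {ys f g h a b} → (∀ i → i ℕ.< j ℕ.+ n → f i ≈ a * g i + b * h i) →
      Δ j n (pre ʳ++ (f ∷ ys)) ≈ a * Δ j n (pre ʳ++ (g ∷ ys)) + b * Δ j n (pre ʳ++ (h ∷ ys))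
    Δ-linear j n pre {ys} {f} {g} {h} f≈
      rewrite ≡.sym (ʳ++-++ pre {[]} {f ∷ ys}) | ≡.sym (ʳ++-++ pre {[]} {g ∷ ys})
        | ≡.sym (ʳ++-++ pre {[]} {h ∷ ys}) = Δ-linear-++ j n (pre ʳ++ []) f≈

  private
    expand-zero : ∀ j n pre → (∀ zs → Δ (suc j) n (pre ʳ++ zs) ≈ 0#) → ∀ ys → expand j n pre ys ≈ 0#
    expand-zero j n pre hyp []       = refl
    expand-zero j n pre hyp (y ∷ ys) = trans
      (+-cong (trans (*-congˡ (hyp ys)) (zeroʳ _))
        (trans (-‿cong (expand-zero j n (y ∷ pre) (λ zs → hyp (y ∷ zs)) ys)) -0#≈0#))
      (+-identityˡ _)

  mutual
    private
      Δ-repeated-++ : ∀ j n xs {f ys} → Δ j n (xs ++ f ∷ f ∷ ys) ≈ 0#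
      Δ-repeated-++ j zero    []      = refl
      Δ-repeated-++ j zero    (_ ∷ _) = refl
      Δ-repeated-++ j (suc n) xs      = expand-repeated j n [] xs

      expand-repeated : ∀ j n pre xs {f ys} → expand j n pre (xs ++ f ∷ f ∷ ys) ≈ 0#
      -- Deleting either copy of `f` leaves the same minor, with opposite signs; every other term
      -- keeps both copies.
      expand-repeated j n pre [] {f} {ys} = trans
        (+-congˡ (-‿cong (+-congˡ (-‿cong (expand-zero j n (f ∷ f ∷ pre) (λ zs → Δ-repeated (suc j) n pre) ys)))))
        (solve 1 (λ a → a :- (a :- con (+ 0)) := con (+ 0)) refl _)
      expand-repeated j n pre (x ∷ xs) {f} {ys} = trans
        (+-cong (*-congˡ (trans (reflexive (≡.cong (Δ (suc j) n) (≡.sym (ʳ++-++ pre {xs} {f ∷ f ∷ ys}))))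
            (Δ-repeated-++ (suc j) n (pre ʳ++ xs))))
          (-‿cong (expand-repeated j n (x ∷ pre) xs)))
        (trans (+-cong (zeroʳ _) -0#≈0#) (+-identityˡ _))

    Δ-repeated : ∀ j n pre {f ys} → Δ j n (pre ʳ++ (f ∷ f ∷ ys)) ≈ 0#
    Δ-repeated j n pre {f} {ys} = trans
      (reflexive (≡.cong (Δ j n) (≡.sym (ʳ++-++ pre {[]} {f ∷ f ∷ ys}))))
      (Δ-repeated-++ j n (pre ʳ++ []))

  Δ-scale : ∀ j n pre {ys f g a} → (∀ i → i ℕ.< j ℕ.+ n → f i ≈ a * g i) →
    Δ j n (pre ʳ++ (f ∷ ys)) ≈ a * Δ j n (pre ʳ++ (g ∷ ys))
  Δ-scale j n pre {g = g} {a} f≈ = trans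
    (Δ-linear j n pre {g = g} {h = g} {a} {0#} λ i i< → trans (f≈ i i<)
      (sym (trans (+-congˡ (zeroˡ _)) (+-identityʳ _))))
    (trans (+-congˡ (zeroˡ _)) (+-identityʳ _))

  -- Polarisation: the determinant with `f+g` in both places vanishes, and so do two of its four
  -- summands.
  Δ-swap : ∀ j n pre {f g ys} →
    Δ j n (pre ʳ++ (f ∷ g ∷ ys)) ≈ - Δ j n (pre ʳ++ (g ∷ f ∷ ys))
  Δ-swap j n pre {f} {g} {ys} = begin
    D f g                              ≈⟨ +-identityʳ _ ⟨
    D f g + 0#                         ≈⟨ +-congˡ (-‿inverseʳ _) ⟨
    D f g + (D g f - D g f)            ≈⟨ +-assoc _ _ _ ⟨
    D f g + D g f - D g f              ≈⟨ +-congʳ sum≈0 ⟩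
    0# - D g f                         ≈⟨ +-identityˡ _ ⟩
    - D g f                            ∎
    where
    D : Row → Row → Carrier
    D p q = Δ j n (pre ʳ++ (p ∷ q ∷ ys))
    f+g : Row
    f+g i = f i + g i
    split : ∀ i → i ℕ.< j ℕ.+ n → f+g i ≈ 1# * f i + 1# * g i
    split i _ = sym (+-cong (*-identityˡ _) (*-identityˡ _))
    unit : ∀ a b → 1# * a + 1# * b ≈ a + b
    unit a b = +-cong (*-identityˡ a) (*-identityˡ b)
    additiveˡ : ∀ p → D f+g p ≈ D f p + D g p
    additiveˡ p = trans (Δ-linear j n pre split) (unit _ _)
    additiveʳ : ∀ p → D p f+g ≈ D p f + D p g
    additiveʳ p = trans (Δ-linear j n (p ∷ pre) split) (unit _ _)
    sum≈0 : D f g + D g f ≈ 0#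
    sum≈0 = begin
      D f g + D g f                      ≈⟨ +-cong (+-identityˡ _) (+-identityʳ _) ⟨
      (0# + D f g) + (D g f + 0#)        ≈⟨ +-cong (+-congʳ (Δ-repeated j n pre)) (+-congˡ (Δ-repeated j n pre)) ⟨
      (D f f + D f g) + (D g f + D g g)  ≈⟨ +-cong (additiveʳ f) (additiveʳ g) ⟨
      D f f+g + D g f+g                  ≈⟨ additiveˡ f+g ⟨
      D f+g f+g                          ≈⟨ Δ-repeated j n pre ⟩
      0#                                 ∎

  Δ-move : ∀ j n pre ys {f zs} →
    Δ j n (pre ʳ++ (ys ++ f ∷ zs)) ≈ (- 1#) ^ length ys * Δ j n (pre ʳ++ (f ∷ ys ++ zs))
  Δ-move j n pre []       = sym (*-identityˡ _)
  Δ-move j n pre (y ∷ ys) = trans (Δ-move j n (y ∷ pre) ys)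
    (trans (*-congˡ (Δ-swap j n pre))
      (solve 2 (λ a b → a :* (:- b) := (:- con (+ 1) :* a) :* b) refl _ _))

  -- Reversal takes the first row past the l others and reverses those, and l + C(l,2) = C(l+1,2).
  -- For blocks of k + 1 rows this is the binomial in the sign of the theorem.
  Δ-reverse : ∀ j n pre ys {zs} →
    Δ j n (pre ʳ++ (ys ʳ++ zs)) ≈ (- 1#) ^ (length ys C 2) * Δ j n (pre ʳ++ (ys ++ zs))
  Δ-reverse j n pre []            = sym (*-identityˡ _)
  Δ-reverse j n pre (y ∷ ys) {zs} = begin
    Δ j n (pre ʳ++ (ys ʳ++ (y ∷ zs)))             ≈⟨ Δ-reverse j n pre ys ⟩
    s (l C 2) * Δ j n (pre ʳ++ (ys ++ y ∷ zs))    ≈⟨ *-congˡ (Δ-move j n pre ys) ⟩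
    s (l C 2) * (s l * D)                         ≈⟨ solve 3 (λ a b d → a :* (b :* d) := (b :* a) :* d) refl _ _ _ ⟩
    (s l * s (l C 2)) * D                         ≈⟨ *-congʳ (^-homo-* (- 1#) l (l C 2)) ⟨
    s (l ℕ.+ l C 2) * D                           ≡⟨ ≡.cong (λ e → s e * D) ([1+n]C2≡n+nC2 l) ⟨
    s (suc l C 2) * D                             ∎
    where
    l = length ys
    s : ℕ → Carrier
    s = (- 1#) ^_
    D = Δ j n (pre ʳ++ (y ∷ ys ++ zs))

  -- Dependence on the preceding rows

  -- A substitute for `f` lying in the span of `pre` on the visible columns. It is closed under
  -- linear combinations and under lengthening of `pre`, over any commutative ring.
  record Null (n : ℕ) (pre : List Row) (f : Row) : Set (c ⊔ ℓ) where
    constructor null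
    field Δ≈0 : ∀ ys → Δ 0 n (pre ʳ++ (f ∷ ys)) ≈ 0#

  open Null public

  Δ-modulo-Null : ∀ n pre {ys f g h a b} → Null n pre h → (∀ i → i ℕ.< n → f i ≈ a * g i + b * h i) →
    Δ 0 n (pre ʳ++ (f ∷ ys)) ≈ a * Δ 0 n (pre ʳ++ (g ∷ ys))
  Δ-modulo-Null n pre {ys} nullʰ f≈ = trans (Δ-linear 0 n pre f≈)
    (trans (+-congˡ (trans (*-congˡ (Δ≈0 nullʰ ys)) (zeroʳ _))) (+-identityʳ _))

  Null-linear : ∀ {n pre f g h a b} → Null n pre g → Null n pre h →
    (∀ i → i ℕ.< n → f i ≈ a * g i + b * h i) → Null n pre f
  Null-linear {n} {pre} nullᵍ nullʰ f≈ = null λ ys →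
    trans (Δ-modulo-Null n pre nullʰ f≈) (trans (*-congˡ (Δ≈0 nullᵍ ys)) (zeroʳ _))

  Null-vanishing : ∀ {n pre f} → (∀ i → i ℕ.< n → f i ≈ 0#) → Null n pre f
  Null-vanishing {n} {pre} {f} f≈0 = null λ ys → trans
    (Δ-scale 0 n pre {g = f} {0#} λ i i<n → trans (f≈0 i i<n) (sym (zeroˡ _))) (zeroˡ _)

  Null-∷ : ∀ {n pre f} g → Null n pre f → Null n (g ∷ pre) f
  Null-∷ {n} {pre} g nullᶠ = null λ ys →
    trans (Δ-swap 0 n pre) (trans (-‿cong (Δ≈0 nullᶠ (g ∷ ys))) -0#≈0#)

  Null-ʳ++ : ∀ {n pre f} xs → Null n pre f → Null n (xs ʳ++ pre) f
  Null-ʳ++ []       nullᶠ = nullᶠ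
  Null-ʳ++ (x ∷ xs) nullᶠ = Null-ʳ++ xs (Null-∷ x nullᶠ)

  Null-head : ∀ {n pre f} → Null n (f ∷ pre) f
  Null-head {n} {pre} = null λ ys → Δ-repeated 0 n pre

  -- Triangular determinants and clearing against a geometric row

  LeadsAt : ℕ → Carrier → Row → Set ℓ
  LeadsAt j a f = (∀ i → i ℕ.< j → f i ≈ 0#) × f j ≈ a

  -- The images of the rows under φ are in echelon form with leading columns
  -- j, j+1, …, and the last argument is the product of the leading entries.
  data Echelon (φ : Row → Row) : ℕ → List Row → Carrier → Set (c ⊔ ℓ) where
    []        : ∀ {j} → Echelon φ j [] 1#
    _∷_       : ∀ {j r rs a b} → LeadsAt j a (φ r) → Echelon φ (suc j) rs b → Echelon φ j (r ∷ rs) (a * b)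
    echelon-≈ : ∀ {j rs a b} → a ≈ b → Echelon φ j rs a → Echelon φ j rs b

  private
    expand-echelon : ∀ i n {j rs d} pre → i ℕ.< j → Echelon (λ r → r) j rs d → expand i n pre rs ≈ 0#
    expand-echelon i n pre i<j [] = refl
    expand-echelon i n {j} pre i<j (_∷_ {r = r} (below , _) ech) = trans
      (+-cong (trans (*-congʳ (below i i<j)) (zeroˡ _))
        (trans (-‿cong (expand-echelon i n (r ∷ pre) (ℕ.m<n⇒m<1+n i<j) ech)) -0#≈0#))
      (+-identityˡ _)
    expand-echelon i n pre i<j (echelon-≈ _ ech) = expand-echelon i n pre i<j ech

    Δ-echelon : ∀ {j rs d} → Echelon (λ r → r) j rs d → Δ j (length rs) rs ≈ d
    Δ-echelon [] = refl
    Δ-echelon {j} (_∷_ {r = r} {rs} (_ , lead) ech) = trans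
      (+-cong (*-cong lead (Δ-echelon ech))
        (trans (-‿cong (expand-echelon j (length rs) (r ∷ []) ℕ.≤-refl ech)) -0#≈0#))
      (+-identityʳ _)
    Δ-echelon (echelon-≈ a≈b ech) = trans (Δ-echelon ech) a≈b

    Echelon-map : ∀ {φ} ψ → (∀ {j a r} → LeadsAt j a (φ r) → LeadsAt (suc j) a (ψ r)) →
      ∀ {j rs d} → Echelon φ j rs d → Echelon (λ r → r) (suc j) (map ψ rs) d
    Echelon-map ψ step []           = []
    Echelon-map ψ step (lead ∷ ech) = step lead ∷ Echelon-map ψ step ech
    Echelon-map ψ step (echelon-≈ a≈b ech) = echelon-≈ a≈b (Echelon-map ψ step ech)

  -- This is q - t applied to `f`: it vanishes as long as `f` continues geometrically with ratio q.
  defect : Carrier → Row → Row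
  defect q f i = q * f i - f (suc i)

  module _ (q : Carrier) where

    private
      clear : Row → Row
      clear r i = r 0 * q ^ i - r i

      -- A cleared row c starts with 0, and c(i+1) is q c(i) plus the defect at i. So it stays 0
      -- until the defect sets in and takes over its leading entry one column later.
      clear-leads : ∀ {j a r} → LeadsAt j a (defect q r) → LeadsAt (suc j) a (clear r)
      clear-leads {j} {a} {r} (below , lead) = below′ , trans (step j) (trans
          (+-cong (trans (*-congˡ (below′ j ℕ.≤-refl)) (zeroʳ q)) lead) (+-identityˡ a))
        where
        step : ∀ i → clear r (suc i) ≈ q * clear r i + defect q r i
        step i = solve 5 (λ r₀ q g rᵢ r′ → r₀ :* (q :* g) :- r′ := q :* (r₀ :* g :- rᵢ) :+ (q :* rᵢ :- r′))
          refl (r 0) q (q ^ i) (r i) (r (suc i))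
        below′ : ∀ i → i ℕ.< suc j → clear r i ≈ 0#
        below′ zero    _         = solve 1 (λ a → a :* con (+ 1) :- a := con (+ 0)) refl (r 0)
        below′ (suc i) (s≤s i<j) = trans (step i) (trans
          (+-cong (trans (*-congˡ (below′ i (ℕ.m<n⇒m<1+n i<j))) (zeroʳ q)) (below i i<j)) (+-identityˡ 0#))

      -- Bringing the geometric row to the front costs one sign for each row passed; replacing that
      -- row by its negative after clearing costs another, and the two cancel.
      clear-rows : ∀ j n pre rs {w ys} → (∀ i → i ℕ.< j ℕ.+ n → w i ≈ q ^ i) →
        Δ j n (pre ʳ++ (rs ++ w ∷ ys)) ≈ Δ j n (pre ʳ++ ((q ^_) ∷ map clear rs ++ ys))
      clear-rows j n pre [] w≈ = trans
        (Δ-scale j n pre {a = 1#} (λ i i< → trans (w≈ i i<) (sym (*-identityˡ _)))) (*-identityˡ _)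
      clear-rows j n pre (r ∷ rs) {w} {ys} w≈ = begin
        Δ j n (pre ʳ++ (r ∷ rs ++ w ∷ ys))     ≈⟨ clear-rows j n (r ∷ pre) rs w≈ ⟩
        D r γ                                  ≈⟨ Δ-swap j n pre ⟩
        - D γ r                                ≈⟨ -‿cong (Δ-linear j n (γ ∷ pre) (λ i _ →
          solve 3 (λ a g b → b := :- con (+ 1) :* (a :* g :- b) :+ a :* g) refl (r 0) (q ^ i) (r i))) ⟩
        - (- 1# * D γ (clear r) + r 0 * D γ γ) ≈⟨ -‿cong (+-congˡ (*-congˡ (Δ-repeated j n pre))) ⟩
        - (- 1# * D γ (clear r) + r 0 * 0#)
          ≈⟨ solve 2 (λ d a → :- (:- con (+ 1) :* d :+ a :* con (+ 0)) := d) refl _ _ ⟩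
        D γ (clear r)                          ∎
        where
        γ : Row
        γ = q ^_
        D : Row → Row → Carrier
        D f g = Δ j n (pre ʳ++ (f ∷ g ∷ map clear rs ++ ys))

    -- Once the geometric row is in front it alone is nonzero in column 0, with entry 1, and the
    -- cleared rows are triangular from column 1 on.
    Δ-bordered-echelon : ∀ {rs d w} → Echelon (defect q) 0 rs d →
      (∀ i → i ℕ.≤ length rs → w i ≈ q ^ i) → Δ 0 (suc (length rs)) (rs ++ w ∷ []) ≈ d
    Δ-bordered-echelon {rs} {d} {w} ech w≈ = begin
      Δ 0 (suc n) (rs ++ w ∷ [])      ≈⟨ clear-rows 0 (suc n) [] rs (λ i i< → w≈ i (ℕ.s≤s⁻¹ i<)) ⟩
      Δ 0 (suc n) (γ ∷ cs ++ [])      ≡⟨ ≡.cong (λ zs → Δ 0 (suc n) (γ ∷ zs)) (++-identityʳ cs) ⟩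
      1# * Δ 1 n cs - expand 0 n (γ ∷ []) cs
        ≈⟨ +-cong (*-identityˡ _) (trans (-‿cong (expand-echelon 0 n (γ ∷ []) (s≤s z≤n) ech′)) -0#≈0#) ⟩
      Δ 1 n cs + 0#                   ≈⟨ +-identityʳ _ ⟩
      Δ 1 n cs                        ≡⟨ ≡.cong (λ m → Δ 1 m cs) (length-map clear rs) ⟨
      Δ 1 (length cs) cs              ≈⟨ Δ-echelon ech′ ⟩
      d                               ∎
      where
      n = length rs
      γ : Row
      γ = q ^_
      cs = map clear rs
      ech′ : Echelon (λ r → r) 1 cs d
      ech′ = Echelon-map clear (λ {_} {_} {r} → clear-leads {r = r}) ech

-- Polynomials in the shift acting on rows

module PolynomialRows {c ℓ : Level} (R : CommutativeRing c ℓ) where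

  open CommutativeRing R hiding (zero)
  open import Algebra.Properties.Semiring.Exp semiring using (_^_)
  open import Relation.Binary.Reasoning.Setoid setoid
  open IntegerSolver R
  open Polynomial R
  open RowDeterminant R

  infixr 5 _▷_

  -- The action of polynomials on rows in which the indeterminate t is the
  -- left shift.
  _▷_ : Poly → Row → Row
  ([] ▷ f) i      = 0#
  ((a ∷ p) ▷ f) i = a * f i + (p ▷ λ j → f (suc j)) i

  ▷-+ : ∀ p q f i → ((p +ₚ q) ▷ f) i ≈ (p ▷ f) i + (q ▷ f) i
  ▷-+ []      q       f i = sym (+-identityˡ _)
  ▷-+ (a ∷ p) []      f i = sym (+-identityʳ _)
  ▷-+ (a ∷ p) (b ∷ q) f i = trans (+-congˡ (▷-+ p q _ i))
    (solve 5 (λ a b f p q → (a :+ b) :* f :+ (p :+ q) := (a :* f :+ p) :+ (b :* f :+ q)) refl _ _ _ _ _)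

  ▷-· : ∀ a p f i → ((a ·ₚ p) ▷ f) i ≈ a * (p ▷ f) i
  ▷-· a []      f i = sym (zeroʳ a)
  ▷-· a (b ∷ p) f i = trans (+-congˡ (▷-· a p _ i))
    (solve 4 (λ a b f p → a :* b :* f :+ a :* p := a :* (b :* f :+ p)) refl _ _ _ _)

  private
    ▷-shift : ∀ p f i → (p ▷ λ j → f (suc j)) i ≡ (p ▷ f) (suc i)
    ▷-shift []      f i = ≡.refl
    ▷-shift (a ∷ p) f i = ≡.cong (λ g → a * f (suc i) + g) (▷-shift p (λ j → f (suc j)) i)

  ▷-t : ∀ p f i → ((0# ∷ p) ▷ f) i ≈ (p ▷ f) (suc i)
  ▷-t p f i = trans (+-cong (zeroˡ _) (reflexive (▷-shift p f i))) (+-identityˡ _)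

  -- Read off the coefficients, since a list may end in coefficients equal to zero and its length
  -- then overstates the degree.
  record DegreeBelow (d : ℕ) (p : Poly) : Set ℓ where
    constructor degreeBelow
    field vanishing : ∀ i → d ℕ.≤ i → coeff p i ≈ 0#

  open DegreeBelow public

  record Monic (d : ℕ) (p : Poly) : Set ℓ where
    constructor monic
    field
      leading : coeff p d ≈ 1#
      degree  : DegreeBelow (suc d) p

  open Monic public

  DegreeBelow-mono : ∀ {d e p} → d ℕ.≤ e → DegreeBelow d p → DegreeBelow e p
  DegreeBelow-mono d≤e deg = degreeBelow λ i e≤i → vanishing deg i (ℕ.≤-trans d≤e e≤i)

  DegreeBelow-tail : ∀ {d a p} → DegreeBelow (suc d) (a ∷ p) → DegreeBelow d p
  DegreeBelow-tail deg = degreeBelow λ i d≤i → vanishing deg (suc i) (s≤s d≤i)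

  DegreeBelow-· : ∀ {d p} a → DegreeBelow d p → DegreeBelow d (a ·ₚ p)
  DegreeBelow-· {p = p} a deg = degreeBelow λ i d≤i →
    trans (coeff-· a p i) (trans (*-congˡ (vanishing deg i d≤i)) (zeroʳ a))

  Monic-t : ∀ {d p} → Monic d p → Monic (suc d) (0# ∷ p)
  Monic-t (monic lead deg) = monic lead (degreeBelow λ { (suc i) (s≤s d<i) → vanishing deg i d<i })

  private
    coeff-+· : ∀ p a q i → coeff q i ≈ 0# → coeff (p +ₚ a ·ₚ q) i ≈ coeff p i
    coeff-+· p a q i q≈0 = trans (coeff-+ p (a ·ₚ q) i) (trans
      (+-congˡ (trans (coeff-· a q i) (trans (*-congˡ q≈0) (zeroʳ a)))) (+-identityʳ _))

  Monic-+· : ∀ {d p q} a → Monic d p → DegreeBelow d q → Monic d (p +ₚ a ·ₚ q)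
  Monic-+· {d} {p} {q} a (monic lead deg) deg′ = monic
    (trans (coeff-+· p a q d (vanishing deg′ d ℕ.≤-refl)) lead)
    (degreeBelow λ i d<i → trans (coeff-+· p a q i (vanishing deg′ i (ℕ.<⇒≤ d<i))) (vanishing deg i d<i))

  shift : ℕ → Row → Row
  shift zero    f = f
  shift (suc d) f = shift d (λ j → f (suc j))

  private
    shift-suc : ∀ d f → shift (suc d) f ≡ (λ j → shift d f (suc j))
    shift-suc zero    f = ≡.refl
    shift-suc (suc d) f = shift-suc d (λ j → f (suc j))

  Null-▷ : ∀ {n pre} d p f → DegreeBelow d p → (∀ i → i ℕ.< d → Null n pre (shift i f)) →
    Null n pre (p ▷ f)
  Null-▷ d []      f deg nulls = Null-vanishing λ _ _ → refl
  Null-▷ zero (a ∷ p) f deg nulls = Null-linear {a = 1#} {0#} rest rest λ i _ → trans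
    (+-congʳ (trans (*-congʳ (vanishing deg 0 z≤n)) (zeroˡ _)))
    (solve 1 (λ g → con (+ 0) :+ g := con (+ 1) :* g :+ con (+ 0) :* g) refl _)
    where rest = Null-▷ zero p (λ j → f (suc j)) (degreeBelow λ i _ → vanishing deg (suc i) z≤n) λ _ ()
  Null-▷ (suc d) (a ∷ p) f deg nulls = Null-linear {b = 1#} (nulls 0 (s≤s z≤n))
    (Null-▷ d p (λ j → f (suc j)) (DegreeBelow-tail deg) (λ i i<d → nulls (suc i) (s≤s i<d)))
    λ i _ → +-congˡ (sym (*-identityˡ _))

  -- All terms of `p` below the leading one give null rows, and the leading coefficient is 1.
  Δ-▷-Monic : ∀ n pre d p f {ys} → Monic d p → (∀ i → i ℕ.< d → Null n pre (shift i f)) →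
    Δ 0 n (pre ʳ++ ((p ▷ f) ∷ ys)) ≈ Δ 0 n (pre ʳ++ (shift d f ∷ ys))
  -- A monic `[]` means 0 = 1 in `R`, so any row may stand for any other.
  Δ-▷-Monic n pre zero [] f (monic lead deg) nulls = trans
    (Δ-scale 0 n pre {a = 1#} λ i _ → trans (sym (zeroˡ _)) (*-congʳ lead)) (*-identityˡ _)
  Δ-▷-Monic n pre (suc d) [] f (monic lead deg) nulls = trans
    (Δ-scale 0 n pre {a = 1#} λ i _ → trans (sym (zeroˡ _)) (*-congʳ lead)) (*-identityˡ _)
  Δ-▷-Monic n pre zero (a ∷ p) f (monic lead deg) nulls = trans
    (Δ-modulo-Null n pre {a = 1#} {1#}
      (Null-▷ zero p (λ j → f (suc j)) (DegreeBelow-tail deg) λ _ ())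
      λ i _ → +-cong (*-congʳ lead) (sym (*-identityˡ _)))
    (*-identityˡ _)
  Δ-▷-Monic n pre (suc d) (a ∷ p) f (monic lead deg) nulls = trans
    (trans (Δ-modulo-Null n pre {g = p ▷ λ j → f (suc j)} {a = 1#} {a} (nulls 0 (s≤s z≤n))
        λ i _ → solve 3 (λ a f g → a :* f :+ g := con (+ 1) :* g :+ a :* f) refl a (f i) _)
      (*-identityˡ _))
    (Δ-▷-Monic n pre d p (λ j → f (suc j)) (monic lead (DegreeBelow-tail deg))
      λ i i<d → nulls (suc i) (s≤s i<d))

  -- As the leading coefficient is 1, dependence of `p ▷ f` passes to the power tᵈ without any
  -- division.
  Null-Monic : ∀ {n pre} d p f → Monic d p → (∀ i → i ℕ.< d → Null n pre (shift i f)) →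
    Null n pre (p ▷ f) → Null n pre (shift d f)
  Null-Monic d p f p-monic nulls nullᵖ =
    null λ ys → trans (sym (Δ-▷-Monic _ _ d p f p-monic nulls)) (Δ≈0 nullᵖ ys)

  private
    <-suc-elim : ∀ {a} (P : ℕ → Set a) {d} → (∀ i → i ℕ.< d → P i) → P d → ∀ i → i ℕ.< suc d → P i
    <-suc-elim P below at i (s≤s i≤d) with ℕ.m≤n⇒m<n∨m≡n i≤d
    ... | inj₁ i<d    = below i i<d
    ... | inj₂ ≡.refl = at

  Null-extend : ∀ {n pre} d p f → Monic d p → Null n pre (p ▷ f) →
    (∀ i → i ℕ.< d → Null n pre (shift i f)) → ∀ i → i ℕ.< suc d → Null n pre (shift i f)
  Null-extend d p f p-monic nullᵖ nulls =
    <-suc-elim (λ i → Null _ _ (shift i f)) nulls (Null-Monic d p f p-monic nulls nullᵖ)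

  powers : Row → ℕ → List Row
  powers f zero    = []
  powers f (suc r) = f ∷ powers (λ j → f (suc j)) r

  powers-+ : ∀ f r s → powers f (r ℕ.+ s) ≡ powers f r ++ powers (shift r f) s
  powers-+ f zero    s = ≡.refl
  powers-+ f (suc r) s = ≡.cong (f ∷_) (powers-+ (λ j → f (suc j)) r s)

  length-powers : ∀ f r → length (powers f r) ≡ r
  length-powers f zero    = ≡.refl
  length-powers f (suc r) = ≡.cong suc (length-powers _ r)

  data MonicRows (f : Row) : ℕ → List Row → Set (c ⊔ ℓ) where
    []  : ∀ {d} → MonicRows f d []
    mon : ∀ {d r rs} p → Monic d p → (∀ i → r i ≈ (p ▷ f) i) → MonicRows f (suc d) rs →
      MonicRows f d (r ∷ rs)

  MonicRows-++ : ∀ {f d xs ys} → MonicRows f d xs → MonicRows f (length xs ℕ.+ d) ys →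
    MonicRows f d (xs ++ ys)
  MonicRows-++ [] mons = mons
  MonicRows-++ {f} {d} {ys = ys} (mon {rs = rs} p p-monic r≈ mons) mons′ = mon p p-monic r≈
    (MonicRows-++ mons (≡.subst (λ e → MonicRows f e ys) (≡.sym (ℕ.+-suc (length rs) d)) mons′))

  -- A unitriangular change of basis, row by row. The second component records that the new rows
  -- make all powers up to their degrees null; this invariant lets the lower terms of later rows be
  -- dropped.
  Δ-▷-rows : ∀ n pre d f {rs ys} → MonicRows f d rs → (∀ i → i ℕ.< d → Null n pre (shift i f)) →
    Δ 0 n (pre ʳ++ (powers (shift d f) (length rs) ++ ys)) ≈ Δ 0 n (pre ʳ++ (rs ++ ys)) ×
    (∀ i → i ℕ.< length rs ℕ.+ d → Null n (rs ʳ++ pre) (shift i f))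
  Δ-▷-rows n pre d f [] nulls = refl , nulls
  Δ-▷-rows n pre d f {rs = r ∷ rs} {ys} (mon p p-monic r≈ mons) nulls =
    trans first (trans (reflexive (≡.cong (λ h → Δ 0 n ((r ∷ pre) ʳ++ (powers h (length rs) ++ ys)))
      (≡.sym (shift-suc d f)))) (proj₁ rest)) ,
    λ i i< → proj₂ rest i (≡.subst (i ℕ.<_) (≡.sym (ℕ.+-suc (length rs) d)) i<)
    where
    first : ∀ {zs} → Δ 0 n (pre ʳ++ (shift d f ∷ zs)) ≈ Δ 0 n (pre ʳ++ (r ∷ zs))
    first = trans (sym (Δ-▷-Monic n pre d p f p-monic nulls))
      (trans (Δ-scale 0 n pre {a = 1#} λ i _ → trans (sym (r≈ i)) (sym (*-identityˡ _))) (*-identityˡ _))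
    nullᵖ : Null n (r ∷ pre) (p ▷ f)
    nullᵖ = Null-linear {a = 1#} {0#} Null-head Null-head λ i _ → trans (sym (r≈ i))
      (solve 1 (λ g → g := con (+ 1) :* g :+ con (+ 0) :* g) refl _)
    rest = Δ-▷-rows n (r ∷ pre) (suc d) f {ys = ys} mons
      (Null-extend d p f p-monic nullᵖ λ i i<d → Null-∷ r (nulls i i<d))

  private
    Null-powers : ∀ {n pre} f r i → i ℕ.< r → Null n (powers f r ʳ++ pre) (shift i f)
    Null-powers f (suc r) zero    _         = Null-ʳ++ (powers (λ j → f (suc j)) r) Null-head
    Null-powers f (suc r) (suc i) (s≤s i<r) = Null-powers (λ j → f (suc j)) r i i<r

  -- If a monic polynomial p of degree m kills f in the first n columns, then
  -- tᵐ may be replaced by − p(0) modulo t, …, tᵐ⁻¹.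
  Δ-companion : ∀ n m p f {ys} → Monic (suc m) p → (∀ i → i ℕ.< n → (p ▷ f) i ≈ 0#) →
    Δ 0 n (powers (λ j → f (suc j)) (suc m) ++ ys) ≈
      (- 1#) ^ suc m * coeff p 0 * Δ 0 n (powers f (suc m) ++ ys)
  Δ-companion n m [] f {ys} (monic lead _) _ = begin
    a                   ≈⟨ *-identityˡ a ⟨
    1# * a              ≈⟨ *-congʳ lead ⟨
    0# * a              ≈⟨ solve 3 (λ a s d → con (+ 0) :* a := s :* con (+ 0) :* d) refl a ((- 1#) ^ suc m) d ⟩
    (- 1#) ^ suc m * 0# * d ∎
    where
    a = Δ 0 n (powers (λ j → f (suc j)) (suc m) ++ ys)
    d = Δ 0 n (powers f (suc m) ++ ys)
  Δ-companion n m (b ∷ p) f {ys} (monic lead deg) kills = begin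
    Δ 0 n (powers f′ (suc m) ++ ys)            ≡⟨ ≡.cong (Δ 0 n) split ⟩
    Δ 0 n (ps ++ shift m f′ ∷ ys)              ≡⟨ ≡.cong (Δ 0 n) (to-pre _) ⟨
    Δ 0 n (pre ʳ++ (shift m f′ ∷ ys))          ≈⟨ Δ-▷-Monic n pre m p f′
      (monic lead (DegreeBelow-tail deg)) (Null-powers f′ m) ⟨
    Δ 0 n (pre ʳ++ ((p ▷ f′) ∷ ys))            ≈⟨ Δ-scale 0 n pre {a = - b} (λ i i<n →
      trans (solve 3 (λ b f g → g := :- b :* f :+ (b :* f :+ g)) refl b (f i) _)
        (trans (+-congˡ (kills i i<n)) (+-identityʳ _))) ⟩
    - b * Δ 0 n (pre ʳ++ (f ∷ ys))             ≡⟨ ≡.cong (λ l → - b * Δ 0 n l) (to-pre _) ⟩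
    - b * Δ 0 n (ps ++ f ∷ ys)                 ≈⟨ *-congˡ (Δ-move 0 n [] ps) ⟩
    - b * ((- 1#) ^ length ps * D)             ≡⟨ ≡.cong (λ l → - b * ((- 1#) ^ l * D)) (length-powers f′ m) ⟩
    - b * ((- 1#) ^ m * D)
      ≈⟨ solve 3 (λ b s d → :- b :* (s :* d) := (:- con (+ 1) :* s) :* b :* d) refl _ _ _ ⟩
    (- 1#) ^ suc m * b * D                     ∎
    where
    f′ : Row
    f′ j = f (suc j)
    ps = powers f′ m
    pre = ps ʳ++ []
    D = Δ 0 n (powers f (suc m) ++ ys)
    to-pre : ∀ zs → pre ʳ++ zs ≡ ps ++ zs
    to-pre zs = ʳ++-ʳ++ ps
    split : powers f′ (suc m) ++ ys ≡ ps ++ shift m f′ ∷ ys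
    split = ≡.trans (≡.cong (_++ ys) (≡.trans (≡.cong (powers f′) (ℕ.+-comm 1 m)) (powers-+ f′ m 1)))
      (++-assoc ps _ ys)

-- Rows of path weights and Chebyshev-like operators

module PathRows {c ℓ : Level} (R : CommutativeRing c ℓ) (x y : CommutativeRing.Carrier R) where

  open CommutativeRing R hiding (zero)
  open import Algebra.Properties.Ring ring
  open import Algebra.Properties.Semiring.Exp semiring using (_^_)
  open import Relation.Binary.Reasoning.Setoid setoid
  open IntegerSolver R
  open Polynomial R
  open RowDeterminant R
  open PolynomialRows R

  -- The sum 1 + (x + y) + xy of the three step weights.
  ratio : Carrier
  ratio = (1# + x) * (1# + y)

  -- σ (suc l) i is the weight of all i-step paths that start at height l and
  -- never run below the axis; σ 0 = 0 is the boundary value at height −1.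
  σ : ℕ → Row
  σ zero    i       = 0#
  σ (suc l) zero    = 1#
  σ (suc l) (suc i) = σ (suc (suc l)) i + (x + y) * σ (suc l) i + x * y * σ l i

  -- A path not longer than its starting height cannot run below the axis.
  σ-geometric : ∀ l i → i ℕ.≤ l → σ (suc l) i ≈ ratio ^ i
  σ-geometric l       zero    _         = refl
  σ-geometric (suc l) (suc i) (s≤s i≤l) = trans
    (+-cong (+-cong (σ-geometric (suc (suc l)) i (ℕ.m≤n⇒m≤1+n (ℕ.m≤n⇒m≤1+n i≤l)))
        (*-congˡ (σ-geometric (suc l) i (ℕ.m≤n⇒m≤1+n i≤l))))
      (*-congˡ (σ-geometric l i i≤l)))
    (solve 3 (λ x y g → g :+ (x :+ y) :* g :+ x :* y :* g :=
      (con (+ 1) :+ x) :* (con (+ 1) :+ y) :* g) refl x y (ratio ^ i))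

  -- Of the paths with l + 1 steps from height l, only the one that always goes down is lost, and
  -- its weight is (xy)ˡ⁺¹.
  σ-diagonal : ∀ l → σ (suc l) (suc l) ≈ ratio ^ suc l - (x * y) ^ suc l
  σ-diagonal zero    = solve 2 (λ x y → con (+ 1) :+ (x :+ y) :* con (+ 1) :+ x :* y :* con (+ 0) :=
    (con (+ 1) :+ x) :* (con (+ 1) :+ y) :* con (+ 1) :- x :* y :* con (+ 1)) refl x y
  σ-diagonal (suc l) = trans
    (+-cong (+-cong (σ-geometric (suc (suc l)) (suc l) (ℕ.n≤1+n _))
        (*-congˡ (σ-geometric (suc l) (suc l) ℕ.≤-refl)))
      (*-congˡ (σ-diagonal l)))
    (solve 4 (λ x y g h → g :+ (x :+ y) :* g :+ x :* y :* (g :- h) :=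
      (con (+ 1) :+ x) :* (con (+ 1) :+ y) :* g :- x :* y :* h) refl x y (ratio ^ suc l) ((x * y) ^ suc l))

  -- The path lost in `σ-diagonal` is the first deviation from geometric growth; its weight is the
  -- source of the power of xy in the theorem.
  σ-defect : ∀ l → LeadsAt l ((x * y) ^ suc l) (defect ratio (σ (suc l)))
  σ-defect l =
    (λ i i<l → trans (+-cong (*-congˡ (σ-geometric l i (ℕ.<⇒≤ i<l))) (-‿cong (σ-geometric l (suc i) i<l)))
      (-‿inverseʳ _)) ,
    trans (+-cong (*-congˡ (σ-geometric l l ℕ.≤-refl)) (-‿cong (σ-diagonal l)))
      (solve 2 (λ g h → g :- (g :- h) := h) refl _ _)

  -- With t = z + x + y + xy/z, the operators cheb 1 a and cheb 2 a are
  -- multiplication by (zᵃ⁺¹ − (xy/z)ᵃ⁺¹)/(z − xy/z) and by zᵃ + (xy/z)ᵃ.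
  centre : Row → Row
  centre f i = f (suc i) - (x + y) * f i

  cheb : Carrier → ℕ → Row → Row
  cheb α zero          f i = α * f i
  cheb α (suc zero)    f   = centre f
  cheb α (suc (suc a)) f i = centre (cheb α (suc a) f) i - x * y * cheb α a f i

  centreₚ : Poly → Poly
  centreₚ p = (0# ∷ p) +ₚ (- (x + y)) ·ₚ p

  chebₚ : Carrier → ℕ → Poly → Poly
  chebₚ α zero          p = α ·ₚ p
  chebₚ α (suc zero)    p = centreₚ p
  chebₚ α (suc (suc a)) p = centreₚ (chebₚ α (suc a) p) +ₚ (- (x * y)) ·ₚ chebₚ α a p

  centre-cong : ∀ {f g} → (∀ i → f i ≈ g i) → ∀ i → centre f i ≈ centre g i
  centre-cong f≈g i = +-cong (f≈g (suc i)) (-‿cong (*-congˡ (f≈g i)))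

  cheb-cong : ∀ α a {f g} → (∀ i → f i ≈ g i) → ∀ i → cheb α a f i ≈ cheb α a g i
  cheb-cong α zero          f≈g i = *-congˡ (f≈g i)
  cheb-cong α (suc zero)    f≈g i = centre-cong f≈g i
  cheb-cong α (suc (suc a)) f≈g i =
    +-cong (centre-cong (cheb-cong α (suc a) f≈g) i) (-‿cong (*-congˡ (cheb-cong α a f≈g i)))

  centreₚ-▷ : ∀ p f i → (centreₚ p ▷ f) i ≈ centre (p ▷ f) i
  centreₚ-▷ p f i = trans (▷-+ (0# ∷ p) ((- (x + y)) ·ₚ p) f i) (+-cong (▷-t p f i)
    (trans (▷-· (- (x + y)) p f i) (sym (-‿distribˡ-* _ _))))

  chebₚ-▷ : ∀ α a p f i → (chebₚ α a p ▷ f) i ≈ cheb α a (p ▷ f) i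
  chebₚ-▷ α zero          p f i = ▷-· α p f i
  chebₚ-▷ α (suc zero)    p f i = centreₚ-▷ p f i
  chebₚ-▷ α (suc (suc a)) p f i = trans (▷-+ (centreₚ (chebₚ α (suc a) p)) _ f i) (+-cong
    (trans (centreₚ-▷ (chebₚ α (suc a) p) f i) (centre-cong (chebₚ-▷ α (suc a) p f) i))
    (trans (▷-· (- (x * y)) (chebₚ α a p) f i)
      (trans (sym (-‿distribˡ-* _ _)) (-‿cong (*-congˡ (chebₚ-▷ α a p f i))))))

  centreₚ-Monic : ∀ {d p} → Monic d p → Monic (suc d) (centreₚ p)
  centreₚ-Monic p-monic = Monic-+· (- (x + y)) (Monic-t p-monic) (degree p-monic)

  mutual
    chebₚ-Monic : ∀ α a {d p} → Monic d p → Monic (suc a ℕ.+ d) (chebₚ α (suc a) p)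
    chebₚ-Monic α zero    p-monic = centreₚ-Monic p-monic
    chebₚ-Monic α (suc a) p-monic = Monic-+· (- (x * y)) (centreₚ-Monic (chebₚ-Monic α a p-monic))
      (DegreeBelow-mono (ℕ.n≤1+n _) (chebₚ-DegreeBelow α a p-monic))

    chebₚ-DegreeBelow : ∀ α a {d p} → Monic d p → DegreeBelow (suc a ℕ.+ d) (chebₚ α a p)
    chebₚ-DegreeBelow α zero    p-monic = DegreeBelow-· α (degree p-monic)
    chebₚ-DegreeBelow α (suc a) p-monic = degree (chebₚ-Monic α a p-monic)

  cheb1ₚ-Monic : ∀ a {d p} → Monic d p → Monic (a ℕ.+ d) (chebₚ 1# a p)
  cheb1ₚ-Monic zero    {d} {p} (monic lead deg) = monic
    (trans (coeff-· 1# p d) (trans (*-identityˡ _) lead)) (DegreeBelow-· 1# deg)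
  cheb1ₚ-Monic (suc a) p-monic = chebₚ-Monic 1# a p-monic

  private
    coeff₀-centreₚ : ∀ p → coeff (centreₚ p) 0 ≈ - (x + y) * coeff p 0
    coeff₀-centreₚ p = trans (coeff-+ (0# ∷ p) ((- (x + y)) ·ₚ p) 0) (trans (+-identityˡ _) (coeff-· (- (x + y)) p 0))

  -- At t = 0 one may take z = −x, and then xy/z = −y.
  coeff₀-cheb2ₚ : ∀ a p → coeff (chebₚ (1# + 1#) a p) 0 ≈ (- 1#) ^ a * (x ^ a + y ^ a) * coeff p 0
  coeff₀-cheb2ₚ zero          p = trans (coeff-· (1# + 1#) p 0) (*-congʳ (sym (*-identityˡ _)))
  coeff₀-cheb2ₚ (suc zero)    p = trans (coeff₀-centreₚ p)
    (solve 3 (λ x y e → :- (x :+ y) :* e :=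
      (:- con (+ 1) :* con (+ 1)) :* (x :* con (+ 1) :+ y :* con (+ 1)) :* e) refl x y (coeff p 0))
  coeff₀-cheb2ₚ (suc (suc a)) p = begin
    coeff (chebₚ α (suc (suc a)) p) 0
      ≈⟨ coeff-+ (centreₚ (chebₚ α (suc a) p)) _ 0 ⟩
    coeff (centreₚ (chebₚ α (suc a) p)) 0 + coeff ((- (x * y)) ·ₚ chebₚ α a p) 0
      ≈⟨ +-cong (coeff₀-centreₚ (chebₚ α (suc a) p)) (coeff-· (- (x * y)) (chebₚ α a p) 0) ⟩
    - (x + y) * coeff (chebₚ α (suc a) p) 0 + - (x * y) * coeff (chebₚ α a p) 0
      ≈⟨ +-cong (*-congˡ (coeff₀-cheb2ₚ (suc a) p)) (*-congˡ (coeff₀-cheb2ₚ a p)) ⟩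
    - (x + y) * ((- 1#) ^ suc a * (x ^ suc a + y ^ suc a) * e) + - (x * y) * ((- 1#) ^ a * (x ^ a + y ^ a) * e)
      ≈⟨ solve 6 (λ x y s u v e →
        :- (x :+ y) :* ((:- con (+ 1) :* s) :* (x :* u :+ y :* v) :* e) :+ :- (x :* y) :* (s :* (u :+ v) :* e) :=
        (:- con (+ 1) :* (:- con (+ 1) :* s)) :* (x :* (x :* u) :+ y :* (y :* v)) :* e)
        refl x y ((- 1#) ^ a) (x ^ a) (y ^ a) e ⟩
    (- 1#) ^ suc (suc a) * (x ^ suc (suc a) + y ^ suc (suc a)) * e ∎
    where
    α = 1# + 1#
    e = coeff p 0

  private
    centre-σ : ∀ l i → centre (σ (suc l)) i ≈ σ (suc (suc l)) i + x * y * σ l i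
    centre-σ l i = solve 5 (λ x y a b d → a :+ (x :+ y) :* b :+ x :* y :* d :- (x :+ y) :* b :=
      a :+ x :* y :* d) refl x y _ _ _

  -- A Chebyshev product formula: `σ l` behaves like a combination of zˡ and (xy/z)ˡ, so zᵃ +
  -- (xy/z)ᵃ sends the index l to l + a and, with the factor (xy)ᵃ, to l - a. Writing l = a + q
  -- keeps the indices nonnegative.
  cheb2-σ : ∀ a q i → cheb (1# + 1#) a (σ (a ℕ.+ q)) i ≈ σ (a ℕ.+ (a ℕ.+ q)) i + (x * y) ^ a * σ q i
  cheb2-σ zero          q i = solve 1 (λ s → (con (+ 1) :+ con (+ 1)) :* s := s :+ con (+ 1) :* s) refl _
  cheb2-σ (suc zero)    q i = trans (centre-σ q i) (+-congˡ (*-congʳ (sym (*-identityʳ _))))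
  cheb2-σ (suc (suc a)) q i = begin
    centre (cheb α (suc a) (σ (suc (suc (a ℕ.+ q))))) i - x * y * cheb α a (σ (suc (suc (a ℕ.+ q)))) i
      ≈⟨ +-cong (centre-cong step₁ i) (-‿cong (*-congˡ (step₂ i))) ⟩
    centre (λ i → σ (suc (suc N)) i + w * σ (suc q) i) i - x * y * (σ (suc N) i + v * σ (suc (suc q)) i)
      ≈⟨ solve 10 (λ x y w v a a′ b b′ n r → (a′ :+ w :* b′) :- (x :+ y) :* (a :+ w :* b) :- x :* y :* (n :+ v :* r) :=
         (a′ :- (x :+ y) :* a) :+ w :* (b′ :- (x :+ y) :* b) :- x :* y :* (n :+ v :* r)) refl _ _ _ _ _ _ _ _ _ _ ⟩
    centre (σ (suc (suc N))) i + w * centre (σ (suc q)) i - x * y * (σ (suc N) i + v * σ (suc (suc q)) i)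
      ≈⟨ +-congʳ (+-cong (centre-σ (suc N) i) (*-congˡ (centre-σ q i))) ⟩
    (σ (suc (suc (suc N))) i + x * y * σ (suc N) i) + w * (σ (suc (suc q)) i + x * y * σ q i)
      - x * y * (σ (suc N) i + v * σ (suc (suc q)) i)
      ≈⟨ solve 6 (λ p v m n r s → (m :+ p :* n) :+ (p :* v) :* (r :+ p :* s) :- p :* (n :+ v :* r) :=
         m :+ (p :* (p :* v)) :* s) refl (x * y) v _ _ _ _ ⟩
    σ (suc (suc (suc N))) i + (x * y) ^ suc (suc a) * σ q i
      ≡⟨ ≡.cong (λ m → σ m i + (x * y) ^ suc (suc a) * σ q i) (≡.cong suc (≡.cong suc (ℕ.+-suc a (suc (a ℕ.+ q))))) ⟨
    σ (suc (suc (a ℕ.+ suc (suc (a ℕ.+ q))))) i + (x * y) ^ suc (suc a) * σ q i ∎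
    where
    α = 1# + 1#
    N = a ℕ.+ suc (a ℕ.+ q)
    v = (x * y) ^ a
    w = (x * y) ^ suc a
    step₁ : ∀ i → cheb α (suc a) (σ (suc (suc (a ℕ.+ q)))) i ≈ σ (suc (suc N)) i + w * σ (suc q) i
    step₁ i = trans (≡.subst (λ m → cheb α (suc a) (σ (suc m)) i ≈ σ (suc (a ℕ.+ suc m)) i + w * σ (suc q) i)
      (ℕ.+-suc a q) (cheb2-σ (suc a) (suc q) i))
      (reflexive (≡.cong (λ m → σ (suc m) i + w * σ (suc q) i) (ℕ.+-suc a (suc (a ℕ.+ q)))))
    step₂ : ∀ i → cheb α a (σ (suc (suc (a ℕ.+ q)))) i ≈ σ (suc N) i + v * σ (suc (suc q)) i
    step₂ i = trans (≡.subst (λ m → cheb α a (σ m) i ≈ σ (a ℕ.+ m) i + v * σ (suc (suc q)) i)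
      (≡.trans (ℕ.+-suc a (suc q)) (≡.cong suc (ℕ.+-suc a q))) (cheb2-σ a (suc (suc q)) i))
      (reflexive (≡.cong (λ m → σ m i + v * σ (suc (suc q)) i) (ℕ.+-suc a (suc (a ℕ.+ q)))))

  module _ {l d f} (f-leads : LeadsAt l d (defect ratio f)) where

    private
      defect-centre : ∀ g i → defect ratio (centre g) i ≈
        defect ratio g (suc i) - (x + y) * defect ratio g i
      defect-centre g i = solve 5 (λ q s a b d → q :* (b :- s :* a) :- (d :- s :* b) :=
        (q :* b :- d) :- s :* (q :* a :- b)) refl ratio (x + y) (g i) (g (suc i)) (g (suc (suc i)))

      defect-step : ∀ a i → defect ratio (cheb 1# (suc (suc a)) f) i ≈
        (defect ratio (cheb 1# (suc a) f) (suc i) - (x + y) * defect ratio (cheb 1# (suc a) f) i)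
          - x * y * defect ratio (cheb 1# a f) i
      defect-step a i = trans
        (solve 6 (λ q p m m′ n n′ → q :* (m :- p :* n) :- (m′ :- p :* n′) := (q :* m :- m′) :- p :* (q :* n :- n′))
          refl ratio (x * y) (centre (cheb 1# (suc a) f) i) (centre (cheb 1# (suc a) f) (suc i))
          (cheb 1# a f i) (cheb 1# a f (suc i)))
        (+-congʳ (defect-centre (cheb 1# (suc a) f) i))

      vanish : ∀ {u v w} s → u ≈ w → v ≈ 0# → u - s * v ≈ w
      vanish s u≈w v≈0 = trans (+-cong u≈w (-‿cong (trans (*-congˡ v≈0) (zeroʳ s))))
        (trans (+-congˡ -0#≈0#) (+-identityʳ _))

    -- The defect commutes with these operators, and `cheb 1# a` is monic of degree a in the left
    -- shift: its leading term moves the leading entry a columns to the left, where the lower terms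
    -- are still 0.
    cheb1-defect : ∀ a j → a ℕ.+ j ≡ l → LeadsAt j d (defect ratio (cheb 1# a f))
    cheb1-defect zero j ≡.refl =
      (λ i i<j → trans (unit i) (proj₁ f-leads i i<j)) , trans (unit j) (proj₂ f-leads)
      where
      unit : ∀ i → defect ratio (cheb 1# zero f) i ≈ defect ratio f i
      unit i = solve 3 (λ q a b → q :* (con (+ 1) :* a) :- con (+ 1) :* b := q :* a :- b) refl ratio _ _
    cheb1-defect (suc zero) j ≡.refl =
      (λ i i<j → trans (defect-centre f i)
        (vanish (x + y) (proj₁ f-leads (suc i) (s≤s i<j)) (proj₁ f-leads i (ℕ.m<n⇒m<1+n i<j)))) ,
      trans (defect-centre f j) (vanish (x + y) (proj₂ f-leads) (proj₁ f-leads j ℕ.≤-refl))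
    cheb1-defect (suc (suc a)) j a+j≡l =
      (λ i i<j → trans (defect-step a i)
        (vanish (x * y) (vanish (x + y) (proj₁ lead₁ (suc i) (s≤s i<j)) (proj₁ lead₁ i (ℕ.m<n⇒m<1+n i<j)))
          (proj₁ lead₀ i (ℕ.m<n⇒m<1+n (ℕ.m<n⇒m<1+n i<j))))) ,
      trans (defect-step a j)
        (vanish (x * y) (vanish (x + y) (proj₂ lead₁) (proj₁ lead₁ j ℕ.≤-refl))
          (proj₁ lead₀ j (ℕ.m<n⇒m<1+n ℕ.≤-refl)))
      where
      lead₁ = cheb1-defect (suc a) (suc j) (≡.trans (ℕ.+-suc (suc a) j) a+j≡l)
      lead₀ = cheb1-defect a (suc (suc j))
        (≡.trans (ℕ.+-suc a (suc j)) (≡.trans (≡.cong suc (ℕ.+-suc a j)) a+j≡l))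

-- The path sums satisfy the recursion of `σ`

private
  path-∷ : ∀ {n k l} s {P : Path n} {k′} → + k ℤ.+ rise s ≡ + k′ →
    P IsPath⁺From k′ To l → (s ∷ P) IsPath⁺From k To l
  path-∷ {k = k} {l} s {P} eq (end , above) =
    ≡.subst (λ h → endHeight h P ≡ + l) (≡.sym eq) end ,
    ℤ.+≤+ z≤n ∷ ≡.subst (λ h → NeverBelowAxis h P) (≡.sym eq) above

  path-tail : ∀ {n k l} s {P : Path n} {k′} → + k ℤ.+ rise s ≡ + k′ →
    (s ∷ P) IsPath⁺From k To l → P IsPath⁺From k′ To l
  path-tail {k = k} {l} s {P} eq (end , _ ∷ above) =
    ≡.subst (λ h → endHeight h P ≡ + l) eq end , ≡.subst (λ h → NeverBelowAxis h P) eq above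

  start-above : ∀ {n} (P : Path n) → ¬ NeverBelowAxis ℤ.-1ℤ P
  start-above []      (() ∷ _)
  start-above (_ ∷ _) (() ∷ _)

module PathSumRecursion {c ℓ : Level} (R : CommutativeRing c ℓ) (x y : CommutativeRing.Carrier R) where

  open CommutativeRing R hiding (zero)
  open import Algebra.Properties.Semiring.Sum semiring using (*-distribˡ-sum)
  open import Algebra.Properties.CommutativeMonoid.Sum +-commutativeMonoid
    using (sum; sum-syntax; sum-cong-≋; ∑-distrib-+; sum-replicate-zero)
  open import Relation.Binary.Reasoning.Setoid setoid
  open PathSums R x y
  open IntegerSolver R
  open PathRows R x y using (σ)

  private
    totalWeight-++ : ∀ {n} (Ps Qs : List (Path n)) →
      totalWeight (Ps ++ Qs) ≈ totalWeight Ps + totalWeight Qs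
    totalWeight-++ []       Qs = sym (+-identityˡ _)
    totalWeight-++ (P ∷ Ps) Qs = trans (+-congˡ (totalWeight-++ Ps Qs)) (sym (+-assoc _ _ _))

    starting : ∀ {n} → Step → ℕ → ℕ → List (Path n) → Carrier
    starting s k l Ps = totalWeight (filter (isPath⁺? k l) (map (s ∷_) Ps))

    starting-≈ : ∀ {n} s k l k′ → + k ℤ.+ rise s ≡ + k′ → (Ps : List (Path n)) →
      starting s k l Ps ≈ stepWeight s * totalWeight (filter (isPath⁺? k′ l) Ps)
    starting-≈ s k l k′ eq [] = sym (zeroʳ _)
    starting-≈ s k l k′ eq (P ∷ Ps) with isPath⁺? k′ l P
    ... | yes p
      rewrite filter-accept (isPath⁺? k l) {s ∷ P} {map (s ∷_) Ps} (path-∷ s eq p)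
        | filter-accept (isPath⁺? k′ l) {P} {Ps} p =
      trans (+-congˡ (starting-≈ s k l k′ eq Ps)) (sym (distribˡ _ _ _))
    ... | no ¬p
      rewrite filter-reject (isPath⁺? k l) {s ∷ P} {map (s ∷_) Ps} (¬p ∘ path-tail s eq)
        | filter-reject (isPath⁺? k′ l) {P} {Ps} ¬p =
      starting-≈ s k l k′ eq Ps

    down-from-axis : ∀ {n} l (Ps : List (Path n)) → starting down 0 l Ps ≈ 0#
    down-from-axis l Ps = reflexive (≡.cong totalWeight (filter-none (isPath⁺? 0 l)
      (All-map⁺ (universal (λ { P (_ , _ ∷ above) → start-above P above }) Ps))))

    below : ℕ → ℕ → ℕ → Carrier
    below n zero    l = 0#
    below n (suc k) l = 𝒫⁺ n k l

    starting-down : ∀ n k l → starting down k l (allPaths n) ≈ x * y * below n k l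
    starting-down n zero    l = trans (down-from-axis l (allPaths n)) (sym (zeroʳ _))
    starting-down n (suc k) l = starting-≈ down (suc k) l k ≡.refl (allPaths n)

  𝒫⁺-suc : ∀ n k l → 𝒫⁺ (suc n) k l ≈ 𝒫⁺ n (suc k) l + (x + y) * 𝒫⁺ n k l + x * y * below n k l
  𝒫⁺-suc n k l = begin
    tw (us ++ ls ++ ds ++ [])              ≈⟨ tw-++ us _ ⟩
    tw us + tw (ls ++ ds ++ [])            ≈⟨ +-congˡ (trans (tw-++ ls _) (+-congˡ (tw-++ ds []))) ⟩
    tw us + (tw ls + (tw ds + 0#))
      ≈⟨ solve 3 (λ u l d → u :+ (l :+ (d :+ con (+ 0))) := u :+ l :+ d) refl _ _ _ ⟩
    tw us + tw ls + tw ds                  ≈⟨ +-cong (+-cong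
      (trans (starting-≈ up k l (suc k) (≡.cong +_ (ℕ.+-comm k 1)) Ps) (*-identityˡ _))
      (starting-≈ level k l k (≡.cong +_ (ℕ.+-identityʳ k)) Ps)) (starting-down n k l) ⟩
    𝒫⁺ n (suc k) l + (x + y) * 𝒫⁺ n k l + x * y * below n k l ∎
    where
    Ps = allPaths n
    us = map (up ∷_) Ps
    ls = map (level ∷_) Ps
    ds = map (down ∷_) Ps
    tw : List (Path (suc n)) → Carrier
    tw Qs = totalWeight (filter (isPath⁺? k l) Qs)
    tw-++ : ∀ Qs Qs′ → tw (Qs ++ Qs′) ≈ tw Qs + tw Qs′
    tw-++ Qs Qs′ = trans (reflexive (≡.cong totalWeight (filter-++ (isPath⁺? k l) Qs Qs′)))
      (totalWeight-++ (filter (isPath⁺? k l) Qs) _)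

  private
    sum-zero : ∀ B {f : Fin B → Carrier} → (∀ l → f l ≈ 0#) → sum f ≈ 0#
    sum-zero B f≈0 = trans (sum-cong-≋ f≈0) (sum-replicate-zero B)

    sum-indicator : ∀ B k (f : ℕ → Carrier) → k ℕ.< B → f k ≈ 1# → (∀ l → l ≢ k → f l ≈ 0#) →
      ∑[ l < B ] f (toℕ l) ≈ 1#
    sum-indicator (suc B) zero f _ at-k off-k = trans
      (+-cong at-k (sum-zero B λ l → off-k (suc (toℕ l)) λ ())) (+-identityʳ _)
    sum-indicator (suc B) (suc k) f (s≤s k<B) at-k off-k = trans
      (+-cong (off-k 0 λ ()) (sum-indicator B k (f ∘ suc) k<B at-k λ l l≢k → off-k (suc l) (l≢k ∘ ℕ.suc-injective)))
      (+-identityˡ _)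

    𝒫⁺-zero-≡ : ∀ k → 𝒫⁺ 0 k k ≈ 1#
    𝒫⁺-zero-≡ k rewrite filter-accept (isPath⁺? k k) {[]} {[]} (≡.refl , ℤ.+≤+ z≤n ∷ []) = +-identityʳ _

    𝒫⁺-zero-≢ : ∀ k l → l ≢ k → 𝒫⁺ 0 k l ≈ 0#
    𝒫⁺-zero-≢ k l l≢k
      rewrite filter-reject (isPath⁺? k l) {[]} {[]} (l≢k ∘ ≡.sym ∘ ℤ.+-injective ∘ proj₁) = refl

  -- The range B is kept free because the recursion combines sums from the heights k - 1, k and k +
  -- 1 over one common range.
  𝒫⁺-sum : ∀ n k B → n ℕ.+ k ℕ.< B → ∑[ l < B ] 𝒫⁺ n k (toℕ l) ≈ σ (suc k) n
  𝒫⁺-sum zero    k B k<B = sum-indicator B k (𝒫⁺ 0 k) k<B (𝒫⁺-zero-≡ k) (𝒫⁺-zero-≢ k)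
  𝒫⁺-sum (suc n) k B n+k<B = begin
    ∑[ l < B ] 𝒫⁺ (suc n) k (toℕ l)
      ≈⟨ sum-cong-≋ {B} (λ l → 𝒫⁺-suc n k (toℕ l)) ⟩
    ∑[ l < B ] (a l + (x + y) * b l + x * y * d l)
      ≈⟨ ∑-distrib-+ (λ l → a l + (x + y) * b l) (λ l → x * y * d l) ⟩
    ∑[ l < B ] (a l + (x + y) * b l) + ∑[ l < B ] (x * y * d l)
      ≈⟨ +-cong (∑-distrib-+ a (λ l → (x + y) * b l)) (sym (*-distribˡ-sum (x * y) d)) ⟩
    sum a + ∑[ l < B ] ((x + y) * b l) + x * y * sum d
      ≈⟨ +-congʳ (+-congˡ (sym (*-distribˡ-sum (x + y) b))) ⟩
    sum a + (x + y) * sum b + x * y * sum d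
      ≈⟨ +-cong (+-cong (𝒫⁺-sum n (suc k) B (≡.subst (ℕ._< B) (≡.sym (ℕ.+-suc n k)) n+k<B))
           (*-congˡ (𝒫⁺-sum n k B (ℕ.<-trans (ℕ.n<1+n _) n+k<B)))) (*-congˡ (below-sum k n+k<B)) ⟩
    σ (suc (suc k)) n + (x + y) * σ (suc k) n + x * y * σ k n ∎
    where
    a b d : Fin B → Carrier
    a l = 𝒫⁺ n (suc k) (toℕ l)
    b l = 𝒫⁺ n k (toℕ l)
    d l = below n k (toℕ l)
    below-sum : ∀ k → suc n ℕ.+ k ℕ.< B → ∑[ l < B ] below n k (toℕ l) ≈ σ k n
    below-sum zero    _ = sum-zero B λ _ → refl
    below-sum (suc k) n+k<B = 𝒫⁺-sum n k B (ℕ.<-trans (ℕ.+-monoʳ-< n (ℕ.n<1+n k)) (ℕ.<-trans (ℕ.n<1+n _) n+k<B))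

  ∑𝒫⁺-σ : ∀ n k → ∑𝒫⁺ n k ≈ σ (suc k) n
  ∑𝒫⁺-σ n k = 𝒫⁺-sum n k (suc (n ℕ.+ k)) (ℕ.n<1+n _)

-- A basis adapted to multiples of K and its determinant

module HankelDeterminants {c ℓ : Level} (R : CommutativeRing c ℓ) (x y : CommutativeRing.Carrier R) (k : ℕ) where

  open CommutativeRing R hiding (zero)
  open import Algebra.Properties.Ring ring
  open import Algebra.Properties.Semiring.Exp semiring using (_^_; ^-homo-*; ^-assocʳ)
  open import Relation.Binary.Reasoning.Setoid setoid
  open IntegerSolver R
  open Polynomial R
  open RowDeterminant R
  open PolynomialRows R
  open PathRows R x y

  K : ℕ
  K = suc k

  base : Row
  base = σ K

  sign : ℕ → Carrier
  sign e = (- 1#) ^ e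

  sign-square : ∀ e → sign e * sign e ≈ 1#
  sign-square zero    = *-identityˡ 1#
  sign-square (suc e) = trans (solve 1 (λ s → (:- con (+ 1) :* s) :* (:- con (+ 1) :* s) := s :* s) refl (sign e))
    (sign-square e)

  -- Q m in the notation of the theorem.
  G : ℕ → Carrier
  G zero          = 0#
  G (suc zero)    = 1#
  G (suc (suc m)) = (x ^ K + y ^ K) * G (suc m) - (x * y) ^ K * G m

  -- V b = u_{Kb−1} / u_{K−1}, where u_a is the polynomial of cheb 1 a.
  V : ℕ → Poly
  V zero          = []
  V (suc zero)    = 1# ∷ []
  V (suc (suc b)) = chebₚ (1# + 1#) K (V (suc b)) +ₚ (- ((x * y) ^ K)) ·ₚ V b

  -- The recursion of `V` is `cheb2-σ` at a = K, solved for its first term: it yields `σ` at K(b+2)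
  -- from `σ` at K(b+1) and at Kb.
  V-▷-base : ∀ b i → (V b ▷ base) i ≈ σ (K ℕ.* b) i
  V-▷-base zero i = reflexive (≡.cong (λ m → σ m i) (≡.sym (ℕ.*-zeroʳ k)))
  V-▷-base (suc zero) i = trans (solve 1 (λ a → con (+ 1) :* a :+ con (+ 0) := a) refl _)
    (reflexive (≡.cong (λ m → σ m i) (≡.sym (ℕ.*-identityʳ K))))
  V-▷-base (suc (suc b)) i = begin
    (V (suc (suc b)) ▷ base) i
      ≈⟨ ▷-+ (chebₚ α K (V (suc b))) _ base i ⟩
    (chebₚ α K (V (suc b)) ▷ base) i + ((- ((x * y) ^ K)) ·ₚ V b ▷ base) i
      ≈⟨ +-cong (trans (chebₚ-▷ α K (V (suc b)) base i) (cheb-cong α K (V-▷-base (suc b)) i))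
           (trans (▷-· (- ((x * y) ^ K)) (V b) base i) (*-congˡ (V-▷-base b i))) ⟩
    cheb α K (σ (K ℕ.* suc b)) i + - ((x * y) ^ K) * σ (K ℕ.* b) i
      ≡⟨ ≡.cong (λ m → cheb α K (σ m) i + - ((x * y) ^ K) * σ (K ℕ.* b) i) (ℕ.*-suc K b) ⟩
    cheb α K (σ (K ℕ.+ K ℕ.* b)) i + - ((x * y) ^ K) * σ (K ℕ.* b) i
      ≈⟨ +-congʳ (cheb2-σ K (K ℕ.* b) i) ⟩
    σ (K ℕ.+ (K ℕ.+ K ℕ.* b)) i + (x * y) ^ K * σ (K ℕ.* b) i + - ((x * y) ^ K) * σ (K ℕ.* b) i
      ≈⟨ solve 3 (λ a p s → a :+ p :* s :+ :- p :* s := a) refl _ _ _ ⟩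
    σ (K ℕ.+ (K ℕ.+ K ℕ.* b)) i
      ≡⟨ ≡.cong (λ m → σ m i) (≡.trans (ℕ.*-suc K (suc b)) (≡.cong (K ℕ.+_) (ℕ.*-suc K b))) ⟨
    σ (K ℕ.* suc (suc b)) i ∎
    where α = 1# + 1#

  mutual
    V-Monic : ∀ b → Monic (K ℕ.* b) (V (suc b))
    V-Monic zero    = ≡.subst (λ d → Monic d (1# ∷ [])) (≡.sym (ℕ.*-zeroʳ k))
      (monic refl (degreeBelow λ { (suc i) _ → refl }))
    V-Monic (suc b) = ≡.subst (λ d → Monic d (V (suc (suc b)))) (≡.sym (ℕ.*-suc K b))
      (Monic-+· (- ((x * y) ^ K)) (chebₚ-Monic (1# + 1#) k (V-Monic b))
        (DegreeBelow-mono (ℕ.m≤n+m (K ℕ.* b) K) (V-DegreeBelow b)))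

    V-DegreeBelow : ∀ b → DegreeBelow (K ℕ.* b) (V b)
    V-DegreeBelow zero    = degreeBelow λ _ _ → refl
    V-DegreeBelow (suc b) = DegreeBelow-mono
      (ℕ.≤-trans (s≤s (ℕ.m≤n+m (K ℕ.* b) k)) (ℕ.≤-reflexive (≡.sym (ℕ.*-suc K b)))) (degree (V-Monic b))

  -- At t = 0 the recursion of `V` becomes that of `G`, with (-1)ᴷ attached to xᴷ + yᴷ. The factor
  -- `sign K` on the left turns an exponent b - 1 into b, which also covers b = 0.
  coeff₀-V : ∀ b → sign K * coeff (V b) 0 ≈ sign K ^ b * G b
  coeff₀-V zero          = trans (zeroʳ _) (sym (zeroʳ _))
  coeff₀-V (suc zero)    = *-congʳ (sym (*-identityʳ _))
  coeff₀-V (suc (suc b)) = begin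
    ε * coeff (V (suc (suc b))) 0
      ≈⟨ *-congˡ (trans (coeff-+ (chebₚ (1# + 1#) K (V (suc b))) _ 0)
           (+-cong (coeff₀-cheb2ₚ K (V (suc b))) (coeff-· (- q) (V b) 0))) ⟩
    ε * (ε * w * coeff (V (suc b)) 0 + - q * coeff (V b) 0)
      ≈⟨ solve 5 (λ ε w q u v → ε :* (ε :* w :* u :+ :- q :* v) := ε :* w :* (ε :* u) :+ :- q :* (ε :* v))
           refl ε w q _ _ ⟩
    ε * w * (ε * coeff (V (suc b)) 0) + - q * (ε * coeff (V b) 0)
      ≈⟨ +-cong (*-congˡ (coeff₀-V (suc b))) (trans (*-congˡ (coeff₀-V b)) (sym (*-identityˡ _))) ⟩
    ε * w * (ε * ε ^ b * G (suc b)) + 1# * (- q * (ε ^ b * G b))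
      -- The inserted square of the sign lifts the exponent in the second term from b to b + 2.
      ≈⟨ +-congˡ (*-congʳ (sign-square K)) ⟨
    ε * w * (ε * ε ^ b * G (suc b)) + ε * ε * (- q * (ε ^ b * G b))
      ≈⟨ solve 6 (λ ε w q e g h → ε :* w :* (ε :* e :* g) :+ ε :* ε :* (:- q :* (e :* h)) :=
           ε :* (ε :* e) :* (w :* g :- q :* h)) refl ε w q (ε ^ b) (G (suc b)) (G b) ⟩
    ε ^ suc (suc b) * G (suc (suc b)) ∎
    where
    ε = sign K
    w = x ^ K + y ^ K
    q = (x * y) ^ K

  coeff₀-V-suc : ∀ b → coeff (V (suc b)) 0 ≈ sign (K ℕ.* b) * G (suc b)
  coeff₀-V-suc b = begin
    v                               ≈⟨ *-identityˡ v ⟨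
    1# * v                          ≈⟨ *-congʳ (sign-square K) ⟨
    sign K * sign K * v             ≈⟨ *-assoc _ _ _ ⟩
    sign K * (sign K * v)           ≈⟨ *-congˡ (coeff₀-V (suc b)) ⟩
    sign K * (sign K * sign K ^ b * G (suc b))
      ≈⟨ solve 3 (λ s e g → s :* (s :* e :* g) := s :* s :* (e :* g)) refl _ _ _ ⟩
    sign K * sign K * (sign K ^ b * G (suc b))   ≈⟨ trans (*-congʳ (sign-square K)) (*-identityˡ _) ⟩
    sign K ^ b * G (suc b)          ≈⟨ *-congʳ (^-assocʳ (- 1#) K b) ⟩
    sign (K ℕ.* b) * G (suc b)      ∎
    where v = coeff (V (suc b)) 0

  us : ℕ → ℕ → Row → List Row
  us a zero    f = []
  us a (suc g) f = cheb 1# a f ∷ us (suc a) g f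

  length-us : ∀ a g f → length (us a g f) ≡ g
  length-us a zero    f = ≡.refl
  length-us a (suc g) f = ≡.cong suc (length-us (suc a) g f)

  -- In the order of `blocks` the degrees of the polynomials increase by one, as the change of basis
  -- requires. In the order of `revBlocks` the leading columns of the defects increase by one,
  -- because a larger index of `cheb 1#` leads further to the left. `tl` is the last, possibly
  -- incomplete, block.
  blocks revBlocks : ℕ → ℕ → List Row → List Row
  blocks b zero    tl = tl
  blocks b (suc m) tl = us 0 K (σ (K ℕ.* suc b)) ++ blocks (suc b) m tl
  revBlocks b zero    tl = tl
  revBlocks b (suc m) tl = us 0 K (σ (K ℕ.* suc b)) ʳ++ revBlocks (suc b) m tl

  us-MonicRows : ∀ b a g → MonicRows base (a ℕ.+ K ℕ.* b) (us a g (σ (K ℕ.* suc b)))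
  us-MonicRows b a zero    = []
  us-MonicRows b a (suc g) = mon (chebₚ 1# a (V (suc b))) (cheb1ₚ-Monic a (V-Monic b))
    (λ i → sym (trans (chebₚ-▷ 1# a (V (suc b)) base i) (cheb-cong 1# a (V-▷-base (suc b)) i)))
    (us-MonicRows b (suc a) g)

  blocks-MonicRows : ∀ b m {tl} → MonicRows base (K ℕ.* (m ℕ.+ b)) tl →
    MonicRows base (K ℕ.* b) (blocks b m tl)
  blocks-MonicRows b zero    mons = mons
  blocks-MonicRows b (suc m) {tl} mons = MonicRows-++ (us-MonicRows b 0 K)
    (≡.subst (λ d → MonicRows base d (blocks (suc b) m tl))
      (≡.trans (ℕ.*-suc K b) (≡.cong (ℕ._+ K ℕ.* b) (≡.sym (length-us 0 K (σ (K ℕ.* suc b))))))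
      (blocks-MonicRows (suc b) m (≡.subst (λ d → MonicRows base (K ℕ.* d) tl) (≡.sym (ℕ.+-suc m b)) mons)))

  length-blocks : ∀ b m tl → length (blocks b m tl) ≡ K ℕ.* m ℕ.+ length tl
  length-blocks b zero    tl = ≡.cong (ℕ._+ length tl) (≡.sym (ℕ.*-zeroʳ K))
  length-blocks b (suc m) tl = ≡.trans (length-++ (us 0 K (σ (K ℕ.* suc b))))
    (≡.trans (≡.cong₂ ℕ._+_ (length-us 0 K (σ (K ℕ.* suc b))) (length-blocks (suc b) m tl))
      (≡.trans (≡.sym (ℕ.+-assoc K (K ℕ.* m) (length tl)))
        (≡.cong (ℕ._+ length tl) (≡.sym (ℕ.*-suc K m)))))

  length-revBlocks : ∀ b m tl → length (revBlocks b m tl) ≡ K ℕ.* m ℕ.+ length tl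
  length-revBlocks b zero    tl = ≡.cong (ℕ._+ length tl) (≡.sym (ℕ.*-zeroʳ K))
  length-revBlocks b (suc m) tl = ≡.trans (length-ʳ++ (us 0 K (σ (K ℕ.* suc b))))
    (≡.trans (≡.cong₂ ℕ._+_ (length-us 0 K (σ (K ℕ.* suc b))) (length-revBlocks (suc b) m tl))
      (≡.trans (≡.sym (ℕ.+-assoc K (K ℕ.* m) (length tl)))
        (≡.cong (ℕ._+ length tl) (≡.sym (ℕ.*-suc K m)))))

  blocks-++ : ∀ b m tl zs → blocks b m tl ++ zs ≡ blocks b m (tl ++ zs)
  blocks-++ b zero    tl zs = ≡.refl
  blocks-++ b (suc m) tl zs = ≡.trans (++-assoc (us 0 K (σ (K ℕ.* suc b))) _ zs)
    (≡.cong (us 0 K (σ (K ℕ.* suc b)) ++_) (blocks-++ (suc b) m tl zs))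

  revBlocks-++ : ∀ b m tl zs → revBlocks b m tl ++ zs ≡ revBlocks b m (tl ++ zs)
  revBlocks-++ b zero    tl zs = ≡.refl
  revBlocks-++ b (suc m) tl zs = ≡.trans (ʳ++-++ (us 0 K (σ (K ℕ.* suc b))))
    (≡.cong (us 0 K (σ (K ℕ.* suc b)) ʳ++_) (revBlocks-++ (suc b) m tl zs))

  Δ-revBlocks : ∀ n pre b m {tl tl′} e →
    (∀ pre → Δ 0 n (pre ʳ++ tl′) ≈ sign e * Δ 0 n (pre ʳ++ tl)) →
    Δ 0 n (pre ʳ++ revBlocks b m tl′) ≈ sign (m ℕ.* (K C 2) ℕ.+ e) * Δ 0 n (pre ʳ++ blocks b m tl)
  Δ-revBlocks n pre b zero    e hyp = hyp pre
  Δ-revBlocks n pre b (suc m) {tl} {tl′} e hyp = begin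
    Δ 0 n (pre ʳ++ (u ʳ++ rb))              ≈⟨ Δ-reverse 0 n pre u ⟩
    sign (length u C 2) * Δ 0 n (pre ʳ++ (u ++ rb))
      ≡⟨ ≡.cong₂ (λ l zs → sign (l C 2) * Δ 0 n zs) (length-us 0 K (σ (K ℕ.* suc b))) (≡.sym (ʳ++-ʳ++ u)) ⟩
    sign (K C 2) * Δ 0 n ((u ʳ++ pre) ʳ++ rb)
      ≈⟨ *-congˡ (Δ-revBlocks n (u ʳ++ pre) (suc b) m e hyp) ⟩
    sign (K C 2) * (sign e′ * Δ 0 n ((u ʳ++ pre) ʳ++ bs))
      ≈⟨ trans (sym (*-assoc _ _ _)) (*-congʳ (sym (^-homo-* (- 1#) (K C 2) e′))) ⟩
    sign (K C 2 ℕ.+ e′) * Δ 0 n ((u ʳ++ pre) ʳ++ bs)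
      ≡⟨ ≡.cong₂ (λ l zs → sign l * Δ 0 n zs) (≡.sym (ℕ.+-assoc (K C 2) (m ℕ.* (K C 2)) e)) (ʳ++-ʳ++ u) ⟩
    sign (suc m ℕ.* (K C 2) ℕ.+ e) * Δ 0 n (pre ʳ++ (u ++ bs)) ∎
    where
    u = us 0 K (σ (K ℕ.* suc b))
    rb = revBlocks (suc b) m tl′
    bs = blocks (suc b) m tl
    e′ = m ℕ.* (K C 2) ℕ.+ e

  -- All rows of a block share the leading entry d. The row of index i leads in column l - i, so the
  -- reversed block fills the columns j, ..., j + g - 1.
  us-Echelon : ∀ {l d f} → LeadsAt l d (defect ratio f) → ∀ a g j {zs e} →
    a ℕ.+ (g ℕ.+ j) ≡ suc l → Echelon (defect ratio) (g ℕ.+ j) zs e →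
    Echelon (defect ratio) j (us a g f ʳ++ zs) (d ^ g * e)
  us-Echelon lead a zero    j eq ech = echelon-≈ (sym (*-identityˡ _)) ech
  us-Echelon {l} {d} {f} lead a (suc g) j {zs} {e} eq ech = echelon-≈
    (solve 3 (λ p d e → p :* (d :* e) := d :* p :* e) refl (d ^ g) d e)
    (us-Echelon lead (suc a) g j eq′ (cheb1-defect lead a (g ℕ.+ j) (ℕ.suc-injective eq′) ∷ ech))
    where
    eq′ : suc (a ℕ.+ (g ℕ.+ j)) ≡ suc l
    eq′ = ≡.trans (≡.sym (ℕ.+-suc a (g ℕ.+ j))) eq

  -- The block over `σ (K * suc c)` has K rows with leading entry (xy)^(K(c+1)). Summing K²(c+1)
  -- over c = b, ..., b + m - 1 gives the first term; e belongs to the tail.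
  blockExponent : ℕ → ℕ → ℕ → ℕ
  blockExponent b m e = K ℕ.* K ℕ.* (m ℕ.* b ℕ.+ suc m C 2) ℕ.+ e

  revBlocks-Echelon : ∀ b m {tl e} → Echelon (defect ratio) (K ℕ.* (m ℕ.+ b)) tl ((x * y) ^ e) →
    Echelon (defect ratio) (K ℕ.* b) (revBlocks b m tl) ((x * y) ^ blockExponent b m e)
  revBlocks-Echelon b zero    {tl} {e} ech =
    echelon-≈ (reflexive (≡.cong (λ z → (x * y) ^ (z ℕ.+ e)) (≡.sym (ℕ.*-zeroʳ (K ℕ.* K))))) ech
  revBlocks-Echelon b (suc m) {tl} {e} ech = echelon-≈ value
    (us-Echelon (σ-defect _) 0 K (K ℕ.* b) (≡.sym (ℕ.*-suc K b))
      (≡.subst (λ j → Echelon (defect ratio) j (revBlocks (suc b) m tl) ((x * y) ^ blockExponent (suc b) m e))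
        (ℕ.*-suc K b)
        (revBlocks-Echelon (suc b) m
          (≡.subst (λ j → Echelon (defect ratio) (K ℕ.* j) tl ((x * y) ^ e)) (≡.sym (ℕ.+-suc m b)) ech))))
    where
    exponent : K ℕ.* suc b ℕ.* K ℕ.+ blockExponent (suc b) m e ≡ blockExponent b (suc m) e
    exponent = ≡.trans (block-exponent K b m (suc m C 2) e)
      (≡.cong (λ t → K ℕ.* K ℕ.* (suc m ℕ.* b ℕ.+ t) ℕ.+ e) (≡.sym ([1+n]C2≡n+nC2 (suc m))))
    value : ((x * y) ^ (K ℕ.* suc b)) ^ K * (x * y) ^ blockExponent (suc b) m e ≈ (x * y) ^ blockExponent b (suc m) e
    value = begin
      ((x * y) ^ (K ℕ.* suc b)) ^ K * (x * y) ^ blockExponent (suc b) m e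
        ≈⟨ *-congʳ (^-assocʳ (x * y) (K ℕ.* suc b) K) ⟩
      (x * y) ^ (K ℕ.* suc b ℕ.* K) * (x * y) ^ blockExponent (suc b) m e
        ≈⟨ ^-homo-* (x * y) (K ℕ.* suc b ℕ.* K) _ ⟨
      (x * y) ^ (K ℕ.* suc b ℕ.* K ℕ.+ blockExponent (suc b) m e)
        ≡⟨ ≡.cong ((x * y) ^_) exponent ⟩
      (x * y) ^ blockExponent b (suc m) e ∎

  -- The last block keeps the index 0, which becomes the geometric border, and the indices a + 1,
  -- ..., a + g. With a + g = k, the choice a = 0 gives a full block, a = k the border alone, and a
  -- = 1 leaves out the row of degree KB + 1.
  basisRows : ℕ → ℕ → ℕ → List Row
  basisRows B a g = blocks 0 B (cheb 1# 0 (σ (K ℕ.* suc B)) ∷ us (suc a) g (σ (K ℕ.* suc B)))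

  -- If g > 0, the largest index in the last block is a + g = k, so after reversal it leads in
  -- column KB, directly behind the B full blocks. The border row is geometric up to column KB + k,
  -- hence in all visible columns.
  Δ-basisRows : ∀ B a g → a ℕ.+ g ≡ k →
    Δ 0 (suc (K ℕ.* B ℕ.+ g)) (basisRows B a g) ≈
      sign (B ℕ.* (K C 2) ℕ.+ suc g C 2) *
      (x * y) ^ (K ℕ.* K ℕ.* (suc B C 2) ℕ.+ g ℕ.* (K ℕ.* suc B))
  Δ-basisRows B a g a+g≡k = begin
    D                                 ≈⟨ *-identityˡ D ⟨
    1# * D                            ≈⟨ *-congʳ (sign-square e) ⟨
    sign e * sign e * D               ≈⟨ *-assoc _ _ _ ⟩
    sign e * (sign e * D)             ≈⟨ *-congˡ (Δ-revBlocks n [] 0 B (suc g C 2) tail-reverse) ⟨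
    sign e * Δ 0 n (revBlocks 0 B (u ʳ++ (w ∷ [])))   ≡⟨ ≡.cong (λ zs → sign e * Δ 0 n zs) as-border ⟩
    sign e * Δ 0 n (rs ++ w ∷ [])     ≡⟨ ≡.cong (λ m → sign e * Δ 0 (suc m) (rs ++ w ∷ [])) length-rs ⟨
    sign e * Δ 0 (suc (length rs)) (rs ++ w ∷ [])  ≈⟨ *-congˡ (Δ-bordered-echelon ratio echelon border) ⟩
    sign e * (x * y) ^ blockExponent 0 B f
      ≡⟨ ≡.cong (λ t → sign e * (x * y) ^ (K ℕ.* K ℕ.* (t ℕ.+ suc B C 2) ℕ.+ f)) (ℕ.*-zeroʳ B) ⟩
    sign e * (x * y) ^ (K ℕ.* K ℕ.* (suc B C 2) ℕ.+ f)
      ≡⟨ ≡.cong (λ t → sign e * (x * y) ^ (K ℕ.* K ℕ.* (suc B C 2) ℕ.+ t)) (ℕ.*-comm (K ℕ.* suc B) g) ⟩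
    sign e * (x * y) ^ (K ℕ.* K ℕ.* (suc B C 2) ℕ.+ g ℕ.* (K ℕ.* suc B)) ∎
    where
    n = suc (K ℕ.* B ℕ.+ g)
    e = B ℕ.* (K C 2) ℕ.+ suc g C 2
    f = K ℕ.* suc B ℕ.* g
    D = Δ 0 n (basisRows B a g)
    s = σ (K ℕ.* suc B)
    w = cheb 1# 0 s
    u = us (suc a) g s
    rs = revBlocks 0 B (u ʳ++ [])
    tail-reverse : ∀ pre → Δ 0 n (pre ʳ++ (u ʳ++ (w ∷ []))) ≈ sign (suc g C 2) * Δ 0 n (pre ʳ++ (w ∷ u))
    tail-reverse pre = trans (Δ-reverse 0 n pre (w ∷ u)) (reflexive
      (≡.cong₂ (λ l zs → sign (suc l C 2) * Δ 0 n (pre ʳ++ (w ∷ zs))) (length-us (suc a) g s) (++-identityʳ u)))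
    as-border : revBlocks 0 B (u ʳ++ (w ∷ [])) ≡ rs ++ w ∷ []
    as-border = ≡.sym (≡.trans (revBlocks-++ 0 B (u ʳ++ []) (w ∷ []))
      (≡.cong (revBlocks 0 B) (ʳ++-++ u)))
    length-rs : length rs ≡ K ℕ.* B ℕ.+ g
    length-rs = ≡.trans (length-revBlocks 0 B (u ʳ++ [])) (≡.cong (K ℕ.* B ℕ.+_)
      (≡.trans (length-ʳ++ u) (≡.trans (ℕ.+-identityʳ _) (length-us (suc a) g s))))
    echelon : Echelon (defect ratio) 0 rs ((x * y) ^ blockExponent 0 B f)
    echelon = ≡.subst (λ j → Echelon (defect ratio) j rs ((x * y) ^ blockExponent 0 B f)) (ℕ.*-zeroʳ k)
      (revBlocks-Echelon 0 B (echelon-≈ (trans (*-identityʳ _) (^-assocʳ (x * y) (K ℕ.* suc B) g))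
        (us-Echelon (σ-defect _) (suc a) g (K ℕ.* (B ℕ.+ 0)) position [])))
      where
      position : suc a ℕ.+ (g ℕ.+ K ℕ.* (B ℕ.+ 0)) ≡ K ℕ.* suc B
      position = ≡.trans (≡.cong suc (≡.sym (ℕ.+-assoc a g _)))
        (≡.trans (≡.cong₂ (λ s t → suc (s ℕ.+ K ℕ.* t)) a+g≡k (ℕ.+-identityʳ B)) (≡.sym (ℕ.*-suc K B)))
    border : ∀ i → i ℕ.≤ length rs → w i ≈ ratio ^ i
    border i i≤ = trans (*-identityˡ _) (σ-geometric _ i (ℕ.≤-trans i≤ (ℕ.≤-trans (ℕ.≤-reflexive length-rs)
      (ℕ.≤-trans (ℕ.+-monoʳ-≤ (K ℕ.* B) (ℕ.≤-trans (ℕ.m≤n+m g a) (ℕ.≤-reflexive a+g≡k)))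
        (ℕ.≤-reflexive (≡.trans (ℕ.+-comm (K ℕ.* B) k) (ℕ.suc-injective (≡.sym (ℕ.*-suc K B)))))))))

  -- The cases of the determinant formula

  base′ : Row
  base′ j = base (suc j)

  D : ℕ → Carrier
  D n = Δ 0 n (powers base′ n)

  private
    Δ-head : ∀ n {rs} ys → MonicRows base (K ℕ.* 0) rs →
      Δ 0 n (powers base (length rs) ++ ys) ≈ Δ 0 n (rs ++ ys) ×
      (∀ i → i ℕ.< length rs → Null n (rs ʳ++ []) (shift i base))
    Δ-head n {rs} ys mons =
      proj₁ res , λ i i< → proj₂ res i (≡.subst (i ℕ.<_) (≡.sym (ℕ.+-identityʳ _)) i<)
      where
      res = Δ-▷-rows n [] 0 base {ys = ys}
        (≡.subst (λ d → MonicRows base d rs) (ℕ.*-zeroʳ K) mons) (λ _ ())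

    tail-MonicRows : ∀ B g → MonicRows base (K ℕ.* (B ℕ.+ 0)) (us 0 g (σ (K ℕ.* suc B)))
    tail-MonicRows B g = ≡.subst (λ b → MonicRows base (K ℕ.* b) (us 0 g (σ (K ℕ.* suc B))))
      (≡.sym (ℕ.+-identityʳ B)) (us-MonicRows B 0 g)

    sign-cancel : ∀ e a → sign e * (sign e * a) ≈ a
    sign-cancel e a = trans (sym (*-assoc _ _ _)) (trans (*-congʳ (sign-square e)) (*-identityˡ a))

    Δ-D : ∀ n → D n ≈ Δ 0 n (powers base′ n ++ [])
    Δ-D n = reflexive (≡.cong (Δ 0 n) (≡.sym (++-identityʳ _)))

  D-multiple : ∀ B → D (K ℕ.* suc B) ≈
    sign (suc B ℕ.* (K C 2)) * (x * y) ^ (K ℕ.* K ℕ.* (suc B C 2) ℕ.+ k ℕ.* (K ℕ.* suc B))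
      * (G (suc (suc B)) + sign k * G (suc B))
  D-multiple B = begin
    D n                                            ≈⟨ Δ-D n ⟩
    Δ 0 n (powers base′ n ++ [])                   ≈⟨ Δ-companion n _ W base W-Monic W-kills ⟩
    sign n * coeff W 0 * Δ 0 n (powers base n ++ [])  ≈⟨ *-cong constant basis ⟩
    (G (suc (suc B)) + sign k * G (suc B)) * (s * p)  ≈⟨ *-comm _ _ ⟩
    s * p * (G (suc (suc B)) + sign k * G (suc B)) ∎
    where
    n = K ℕ.* suc B
    W = V (suc (suc B)) +ₚ (- 1#) ·ₚ V (suc B)
    s = sign (suc B ℕ.* (K C 2))
    p = (x * y) ^ (K ℕ.* K ℕ.* (suc B C 2) ℕ.+ k ℕ.* n)

    W-Monic : Monic n W
    W-Monic = Monic-+· (- 1#) (V-Monic (suc B)) (V-DegreeBelow (suc B))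

    W-kills : ∀ i → i ℕ.< n → (W ▷ base) i ≈ 0#
    W-kills i i<n = begin
      (W ▷ base) i
        ≈⟨ trans (▷-+ (V (suc (suc B))) _ base i) (+-congˡ (▷-· (- 1#) (V (suc B)) base i)) ⟩
      (V (suc (suc B)) ▷ base) i + - 1# * (V (suc B) ▷ base) i
        ≈⟨ +-cong (V-▷-base (suc (suc B)) i) (*-congˡ (V-▷-base (suc B) i)) ⟩
      σ (K ℕ.* suc (suc B)) i + - 1# * σ n i
        ≈⟨ +-cong (σ-geometric _ i (ℕ.≤-trans (ℕ.s≤s⁻¹ i<n)
             (ℕ.s≤s⁻¹ (ℕ.*-monoʳ-≤ K (ℕ.n≤1+n (suc B)))))) (*-congˡ (σ-geometric _ i (ℕ.s≤s⁻¹ i<n))) ⟩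
      ratio ^ i + - 1# * ratio ^ i
        ≈⟨ solve 1 (λ r → r :+ :- con (+ 1) :* r := con (+ 0)) refl _ ⟩
      0# ∎

    -- The sign (-1)ᵏ collects the -1 from the difference `W` and the product of (-1)ⁿ and
    -- (-1)^(KB), which is (-1)ᴷ.
    constant : sign n * coeff W 0 ≈ G (suc (suc B)) + sign k * G (suc B)
    constant = begin
      sign n * coeff W 0
        ≈⟨ *-congˡ (trans (coeff-+ (V (suc (suc B))) _ 0) (+-cong (coeff₀-V-suc (suc B))
             (trans (coeff-· (- 1#) (V (suc B)) 0) (*-congˡ (coeff₀-V-suc B))))) ⟩
      sign n * (sign n * g₂ + - 1# * (t * g₁))
        ≈⟨ trans (distribˡ _ _ _) (+-congʳ (sign-cancel n g₂)) ⟩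
      g₂ + sign n * (- 1# * (t * g₁))
        ≈⟨ +-congˡ (*-congʳ (trans (reflexive (≡.cong sign (ℕ.*-suc K B))) (^-homo-* (- 1#) K (K ℕ.* B)))) ⟩
      g₂ + (- 1# * sign k) * t * (- 1# * (t * g₁))
        ≈⟨ +-congˡ (solve 3 (λ s t g → (:- con (+ 1) :* s) :* t :* (:- con (+ 1) :* (t :* g)) := s :* (t :* (t :* g))) refl _ _ _) ⟩
      g₂ + sign k * (t * (t * g₁))   ≈⟨ +-congˡ (*-congˡ (sign-cancel (K ℕ.* B) g₁)) ⟩
      g₂ + sign k * g₁               ∎
      where
      g₁ = G (suc B)
      g₂ = G (suc (suc B))
      t = sign (K ℕ.* B)

    rows-length : length (basisRows B 0 k) ≡ n
    rows-length = ≡.trans (length-blocks 0 B _) (≡.trans (≡.cong (λ l → K ℕ.* B ℕ.+ suc l) (length-us 1 k (σ n)))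
      (≡.trans (ℕ.+-comm (K ℕ.* B) K) (≡.sym (ℕ.*-suc K B))))

    basis : Δ 0 n (powers base n ++ []) ≈ s * p
    basis = begin
      Δ 0 n (powers base n ++ [])
        ≡⟨ ≡.cong (λ l → Δ 0 n (powers base l ++ [])) rows-length ⟨
      Δ 0 n (powers base (length (basisRows B 0 k)) ++ [])
        ≈⟨ proj₁ (Δ-head n [] (blocks-MonicRows 0 B (tail-MonicRows B K))) ⟩
      Δ 0 n (basisRows B 0 k ++ [])
        ≡⟨ ≡.cong₂ Δ₀ (≡.trans (ℕ.*-suc K B) (≡.trans (ℕ.+-comm K (K ℕ.* B)) (ℕ.+-suc _ k))) (++-identityʳ (basisRows B 0 k)) ⟩
      Δ 0 (suc (K ℕ.* B ℕ.+ k)) (basisRows B 0 k)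
        ≈⟨ Δ-basisRows B 0 k ≡.refl ⟩
      sign (B ℕ.* (K C 2) ℕ.+ K C 2) * p
        ≡⟨ ≡.cong (λ e → sign e * p) (ℕ.+-comm (B ℕ.* (K C 2)) (K C 2)) ⟩
      s * p ∎
      where
      Δ₀ : ℕ → List Row → Carrier
      Δ₀ = Δ 0

  private
    module _ (B : ℕ) where

      s : Row
      s = σ (K ℕ.* suc B)

      m : ℕ
      m = suc (K ℕ.* B)

      -- As `s` is `σ (suc l)`, it is geometric up to column l, and `W` annihilates `base` in the
      -- columns below l. Hence the bound n ≤ l in what follows.
      l : ℕ
      l = K ℕ.* B ℕ.+ k

      W : Poly
      W = (0# ∷ V (suc B)) +ₚ (- ratio) ·ₚ V (suc B)

      W-Monic : Monic m W
      W-Monic = Monic-+· (- ratio) (Monic-t (V-Monic B)) (degree (V-Monic B))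

      s-leads : LeadsAt l ((x * y) ^ suc l) (defect ratio s)
      s-leads = ≡.subst (λ e → LeadsAt l ((x * y) ^ suc l) (defect ratio (σ e)))
        (≡.trans (≡.sym (ℕ.+-suc (K ℕ.* B) k)) (≡.trans (ℕ.+-comm (K ℕ.* B) K) (≡.sym (ℕ.*-suc K B))))
        (σ-defect l)

      W-kills : ∀ i → i ℕ.< l → (W ▷ base) i ≈ 0#
      W-kills i i<l = begin
        (W ▷ base) i
          ≈⟨ trans (▷-+ (0# ∷ V (suc B)) ((- ratio) ·ₚ V (suc B)) base i)
               (+-cong (▷-t (V (suc B)) base i) (▷-· (- ratio) (V (suc B)) base i)) ⟩
        (V (suc B) ▷ base) (suc i) + - ratio * (V (suc B) ▷ base) i
          ≈⟨ +-cong (V-▷-base (suc B) (suc i)) (*-congˡ (V-▷-base (suc B) i)) ⟩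
        s (suc i) + - ratio * s i
          ≈⟨ solve 3 (λ a r b → a :+ :- r :* b := :- (r :* b :- a)) refl _ _ _ ⟩
        - defect ratio s i   ≈⟨ -‿cong (proj₁ s-leads i i<l) ⟩
        - 0#                 ≈⟨ -0#≈0# ⟩
        0#                   ∎

      constant : sign m * coeff W 0 ≈ ratio * G (suc B)
      constant = begin
        sign m * coeff W 0
          ≈⟨ *-congˡ (trans (coeff-+ (0# ∷ V (suc B)) ((- ratio) ·ₚ V (suc B)) 0)
               (+-congˡ (trans (coeff-· (- ratio) (V (suc B)) 0) (*-congˡ (coeff₀-V-suc B))))) ⟩
        (- 1# * t) * (0# + - ratio * (t * G (suc B)))
          ≈⟨ solve 3 (λ t r g → (:- con (+ 1) :* t) :* (con (+ 0) :+ :- r :* (t :* g)) := r :* (t :* (t :* g))) refl _ _ _ ⟩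
        ratio * (t * (t * G (suc B)))
          ≈⟨ *-congˡ (sign-cancel (K ℕ.* B) (G (suc B))) ⟩
        ratio * G (suc B) ∎
        where t = sign (K ℕ.* B)

      head : List Row
      head = basisRows B k 0

      length-head : length head ≡ m
      length-head = ≡.trans (length-blocks 0 B _) (ℕ.+-comm (K ℕ.* B) 1)

      head-MonicRows : MonicRows base (K ℕ.* 0) head
      head-MonicRows = blocks-MonicRows 0 B (tail-MonicRows B 1)

      D-companion : ∀ n ys → n ℕ.≤ l →
        Δ 0 n (powers base′ m ++ ys) ≈ ratio * G (suc B) * Δ 0 n (head ++ ys)
      D-companion n ys n≤l = trans
        (Δ-companion n (K ℕ.* B) W base W-Monic (λ i i<n → W-kills i (ℕ.<-≤-trans i<n n≤l)))
        (*-cong constant (trans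
          (reflexive (≡.cong (λ r → Δ 0 n (powers base r ++ ys)) (≡.sym length-head)))
          (proj₁ (Δ-head n ys head-MonicRows))))

      -- Only m rows make m + 1 powers null: `W` is monic of degree m and kills `base` in all
      -- visible columns, so tᵐ adds nothing.
      head-nulls : ∀ n → n ℕ.≤ l → ∀ i → i ℕ.< suc m → Null n (head ʳ++ []) (shift i base)
      head-nulls n n≤l = Null-extend m W base W-Monic
        (Null-vanishing λ i i<n → W-kills i (ℕ.<-≤-trans i<n n≤l))
        (λ i i<m → proj₂ (Δ-head n [] head-MonicRows) i (≡.subst (i ℕ.<_) (≡.sym length-head) i<m))

      split : ∀ g → powers base′ (m ℕ.+ g) ≡ powers base′ m ++ powers (shift (suc m) base) g
      split g = powers-+ base′ m g

  D-multiple+1 : 1 ℕ.≤ k → ∀ B → D (suc (K ℕ.* B)) ≈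
    sign (B ℕ.* (K C 2)) * (x * y) ^ (K ℕ.* K ℕ.* (suc B C 2)) * (ratio * G (suc B))
  D-multiple+1 1≤k B = begin
    D n                                       ≈⟨ Δ-D n ⟩
    Δ 0 n (powers base′ n ++ [])
      ≈⟨ D-companion B n [] (ℕ.≤-trans (ℕ.≤-reflexive (ℕ.+-comm 1 _)) (ℕ.+-monoʳ-≤ (K ℕ.* B) 1≤k)) ⟩
    ratio * G (suc B) * Δ 0 n (head B ++ [])
      ≡⟨ ≡.cong₂ (λ e zs → ratio * G (suc B) * Δ 0 (suc e) zs) (≡.sym (ℕ.+-identityʳ (K ℕ.* B))) (++-identityʳ (head B)) ⟩
    ratio * G (suc B) * Δ 0 (suc (K ℕ.* B ℕ.+ 0)) (head B)
      ≈⟨ trans (*-congˡ (Δ-basisRows B k 0 (ℕ.+-identityʳ k))) (*-comm _ _) ⟩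
    sign (B ℕ.* (K C 2) ℕ.+ 0) * (x * y) ^ (K ℕ.* K ℕ.* (suc B C 2) ℕ.+ 0) * (ratio * G (suc B))
      ≡⟨ ≡.cong₂ (λ e f → sign e * (x * y) ^ f * (ratio * G (suc B)))
           (ℕ.+-identityʳ (B ℕ.* (K C 2))) (ℕ.+-identityʳ (K ℕ.* K ℕ.* (suc B C 2))) ⟩
    sign (B ℕ.* (K C 2)) * (x * y) ^ (K ℕ.* K ℕ.* (suc B C 2)) * (ratio * G (suc B)) ∎
    where n = suc (K ℕ.* B)

  -- Here n = l, the largest size covered by `W`. The power tᵐ has been traded for the constant, so
  -- the remaining powers start at tᵐ⁺¹ and the index 1 is missing from the last block.
  D-multiple+k : ∀ g → k ≡ suc g → ∀ B → D (suc (K ℕ.* B ℕ.+ g)) ≈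
    sign (B ℕ.* (K C 2) ℕ.+ k C 2) * (x * y) ^ (K ℕ.* K ℕ.* (suc B C 2) ℕ.+ g ℕ.* (K ℕ.* suc B))
      * (ratio * G (suc B))
  D-multiple+k g k≡1+g B = begin
    D n                                        ≡⟨ ≡.cong (Δ 0 n) (split B g) ⟩
    Δ 0 n (powers base′ (m B) ++ ps)           ≈⟨ D-companion B n ps n≤l ⟩
    ratio * G (suc B) * Δ 0 n (head B ++ ps)   ≈⟨ *-congˡ tail-basis ⟩
    ratio * G (suc B) * Δ 0 n (basisRows B 1 g) ≈⟨ trans (*-congˡ (Δ-basisRows B 1 g (≡.sym k≡1+g))) (*-comm _ _) ⟩
    sign (B ℕ.* (K C 2) ℕ.+ suc g C 2) * p * (ratio * G (suc B))
      ≡⟨ ≡.cong (λ t → sign (B ℕ.* (K C 2) ℕ.+ t C 2) * p * (ratio * G (suc B))) k≡1+g ⟨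
    sign (B ℕ.* (K C 2) ℕ.+ k C 2) * p * (ratio * G (suc B)) ∎
    where
    n = suc (K ℕ.* B ℕ.+ g)
    p = (x * y) ^ (K ℕ.* K ℕ.* (suc B C 2) ℕ.+ g ℕ.* (K ℕ.* suc B))
    ps = powers (shift (suc (m B)) base) g
    u = us 2 g (s B)
    n≤l : n ℕ.≤ l B
    n≤l = ℕ.≤-reflexive (≡.trans (≡.sym (ℕ.+-suc (K ℕ.* B) g)) (≡.cong (K ℕ.* B ℕ.+_) (≡.sym k≡1+g)))
    pre = head B ʳ++ []
    tail-basis : Δ 0 n (head B ++ ps) ≈ Δ 0 n (basisRows B 1 g)
    tail-basis = begin
      Δ 0 n (head B ++ ps)
        ≡⟨ ≡.cong (Δ 0 n) (≡.trans (ʳ++-ʳ++ (head B)) (≡.cong (head B ++_) (++-identityʳ ps))) ⟨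
      Δ 0 n (pre ʳ++ (ps ++ []))
        ≡⟨ ≡.cong (λ r → Δ 0 n (pre ʳ++ (powers (shift (suc (m B)) base) r ++ []))) (length-us 2 g (s B)) ⟨
      Δ 0 n (pre ʳ++ (powers (shift (suc (m B)) base) (length u) ++ []))
        ≈⟨ proj₁ (Δ-▷-rows n pre (suc (m B)) base {ys = []} (us-MonicRows B 2 g) (head-nulls B n n≤l)) ⟩
      Δ 0 n (pre ʳ++ (u ++ []))
        ≡⟨ ≡.cong (Δ 0 n) (≡.trans (ʳ++-ʳ++ (head B)) (≡.trans (≡.cong (head B ++_) (++-identityʳ u)) (blocks-++ 0 B _ u))) ⟩
      Δ 0 n (basisRows B 1 g) ∎

  D-other : ∀ B g → suc (suc g) ℕ.< k → D (suc (K ℕ.* B) ℕ.+ suc g) ≈ 0#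
  D-other B g 2+g<k = begin
    D n                                        ≡⟨ ≡.cong (Δ 0 n) (split B (suc g)) ⟩
    Δ 0 n (powers base′ (m B) ++ τ ∷ ps)       ≈⟨ D-companion B n (τ ∷ ps) (ℕ.<⇒≤ n<l) ⟩
    ratio * G (suc B) * Δ 0 n (head B ++ τ ∷ ps)
      ≡⟨ ≡.cong (λ zs → ratio * G (suc B) * Δ 0 n zs) (ʳ++-ʳ++ (head B)) ⟨
    ratio * G (suc B) * Δ 0 n (pre ʳ++ (τ ∷ ps)) ≈⟨ *-congˡ (Δ≈0 τ-null ps) ⟩
    ratio * G (suc B) * 0#                     ≈⟨ zeroʳ _ ⟩
    0#                                         ∎
    where
    n = suc (K ℕ.* B) ℕ.+ suc g
    τ = shift (suc (m B)) base
    ps = powers (λ j → τ (suc j)) g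
    pre = head B ʳ++ []
    n<l : n ℕ.< l B
    n<l = ℕ.≤-trans (ℕ.≤-reflexive (≡.trans (≡.cong suc (≡.sym (ℕ.+-suc (K ℕ.* B) (suc g)))) (≡.sym (ℕ.+-suc (K ℕ.* B) (suc (suc g))))))
      (ℕ.+-monoʳ-≤ (K ℕ.* B) 2+g<k)
    τ-null : Null n pre τ
    τ-null = Null-Monic (suc (m B)) (0# ∷ W B) base (Monic-t (W-Monic B)) (head-nulls B n (ℕ.<⇒≤ n<l))
      -- As n < l, there is one more column in which `W` vanishes, and the factor t uses it up.
      (Null-vanishing λ i i<n → trans (▷-t (W B) base i) (W-kills B (suc i) (ℕ.≤-<-trans i<n n<l)))

  module _ (Q : ℕ → Carrier) (G≈Q : ∀ m → G m ≈ Q m) where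

    D-case₀ : ∀ n → 1 ℕ.≤ n → ∀ n₁ → n ≡ K ℕ.* n₁ →
      D n ≈ sign (n₁ ℕ.* (K C 2)) * (x * y) ^ (K ℕ.^ 2 ℕ.* (suc n₁ C 2) ℕ.∸ n) * (Q (suc n₁) + sign k * Q n₁)
    D-case₀ n 1≤n zero     n≡ = contradiction (≡.trans n≡ (ℕ.*-zeroʳ K)) (ℕ.m<n⇒n≢0 1≤n)
    D-case₀ _ _   (suc B) ≡.refl = trans (D-multiple B) (*-cong
      (reflexive (≡.cong (λ e → sign (suc B ℕ.* (K C 2)) * (x * y) ^ e) (≡.sym (multiple-exponent k (suc B)))))
      (+-cong (G≈Q (suc (suc B))) (*-congˡ (G≈Q (suc B)))))

    D-case₁ : ∀ n → 1 ℕ.≤ k → ∀ n₁ → n ≡ K ℕ.* n₁ ℕ.+ 1 →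
      D n ≈ sign (n₁ ℕ.* (K C 2)) * (x * y) ^ (K ℕ.^ 2 ℕ.* (suc n₁ C 2)) * (1# + x) * (1# + y) * Q (suc n₁)
    D-case₁ _ 1≤k n₁ ≡.refl = begin
      D (K ℕ.* n₁ ℕ.+ 1)             ≡⟨ ≡.cong D (ℕ.+-comm (K ℕ.* n₁) 1) ⟩
      D (suc (K ℕ.* n₁))             ≈⟨ D-multiple+1 1≤k n₁ ⟩
      ε * (x * y) ^ (K ℕ.* K ℕ.* (suc n₁ C 2)) * ((1# + x) * (1# + y) * G (suc n₁))
        ≡⟨ ≡.cong (λ e → ε * (x * y) ^ e * ((1# + x) * (1# + y) * G (suc n₁))) (square-exponent k (suc n₁ C 2)) ⟨
      ε * (x * y) ^ (K ℕ.^ 2 ℕ.* (suc n₁ C 2)) * ((1# + x) * (1# + y) * G (suc n₁))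
        ≈⟨ solve 4 (λ p a b g → p :* (a :* b :* g) := p :* a :* b :* g) refl _ _ _ _ ⟩
      ε * (x * y) ^ (K ℕ.^ 2 ℕ.* (suc n₁ C 2)) * (1# + x) * (1# + y) * G (suc n₁)
        ≈⟨ *-congˡ (G≈Q (suc n₁)) ⟩
      ε * (x * y) ^ (K ℕ.^ 2 ℕ.* (suc n₁ C 2)) * (1# + x) * (1# + y) * Q (suc n₁) ∎
      where ε = sign (n₁ ℕ.* (K C 2))

    D-caseₖ : ∀ n g → k ≡ suc g → ∀ n₁ → n ≡ K ℕ.* n₁ ℕ.+ k →
      D n ≈ sign (suc n₁ ℕ.* (K C 2) ℕ.+ k)
        * (x * y) ^ (K ℕ.^ 2 ℕ.* (suc n₁ C 2) ℕ.+ (k ℕ.^ 2 ℕ.∸ 1) ℕ.* suc n₁) * (1# + x) * (1# + y) * Q (suc n₁)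
    D-caseₖ _ g k≡1+g n₁ ≡.refl = begin
      D (K ℕ.* n₁ ℕ.+ k)              ≡⟨ ≡.cong D (≡.trans (≡.cong (K ℕ.* n₁ ℕ.+_) k≡1+g) (ℕ.+-suc (K ℕ.* n₁) g)) ⟩
      D (suc (K ℕ.* n₁ ℕ.+ g))        ≈⟨ D-multiple+k g k≡1+g n₁ ⟩
      sign e * (x * y) ^ (K ℕ.* K ℕ.* (suc n₁ C 2) ℕ.+ g ℕ.* (K ℕ.* suc n₁)) * ((1# + x) * (1# + y) * G (suc n₁))
        ≈⟨ *-congʳ (*-cong sign-≈ (reflexive (≡.cong ((x * y) ^_) exponent-≡))) ⟩
      ε * p * ((1# + x) * (1# + y) * G (suc n₁))
        ≈⟨ solve 4 (λ p a b g → p :* (a :* b :* g) := p :* a :* b :* g) refl _ _ _ _ ⟩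
      ε * p * (1# + x) * (1# + y) * G (suc n₁)
        ≈⟨ *-congˡ (G≈Q (suc n₁)) ⟩
      ε * p * (1# + x) * (1# + y) * Q (suc n₁) ∎
      where
      e = n₁ ℕ.* (K C 2) ℕ.+ k C 2
      ε = sign (suc n₁ ℕ.* (K C 2) ℕ.+ k)
      p = (x * y) ^ (K ℕ.^ 2 ℕ.* (suc n₁ C 2) ℕ.+ (k ℕ.^ 2 ℕ.∸ 1) ℕ.* suc n₁)
      exponent-≡ : K ℕ.* K ℕ.* (suc n₁ C 2) ℕ.+ g ℕ.* (K ℕ.* suc n₁) ≡
        K ℕ.^ 2 ℕ.* (suc n₁ C 2) ℕ.+ (k ℕ.^ 2 ℕ.∸ 1) ℕ.* suc n₁
      exponent-≡ = ≡.cong₂ ℕ._+_ (≡.sym (square-exponent k (suc n₁ C 2)))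
        (≡.subst (λ m → g ℕ.* (suc m ℕ.* suc n₁) ≡ (m ℕ.^ 2 ℕ.∸ 1) ℕ.* suc n₁) (≡.sym k≡1+g)
          (≡.sym (multiple+k-exponent g n₁)))
      sign-≈ : sign e ≈ ε
      sign-≈ = begin
        sign e                         ≈⟨ *-identityˡ _ ⟨
        1# * sign e                    ≈⟨ *-congʳ (trans (^-homo-* (- 1#) k k) (sign-square k)) ⟨
        sign (k ℕ.+ k) * sign e        ≈⟨ ^-homo-* (- 1#) (k ℕ.+ k) e ⟨
        sign (k ℕ.+ k ℕ.+ e)           ≡⟨ ≡.cong sign (multiple+k-sign k n₁) ⟨
        ε                              ∎

    D-case-other : ∀ n → ¬ (n ≡ 0 [mod K ]) → ¬ (n ≡ 1 [mod K ]) → ¬ (n ≡ k [mod K ]) → D n ≈ 0#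
    D-case-other n r≢0 r≢1 r≢k = by-remainder (n % K) ≡.refl
      where
      n≡ : n ≡ n % K ℕ.+ (n / K) ℕ.* K
      n≡ = m≡m%n+[m/n]*n n K
      by-remainder : ∀ r → n % K ≡ r → D n ≈ 0#
      by-remainder zero          r≡ = contradiction r≡ r≢0
      by-remainder (suc zero)    r≡ = contradiction (≡.trans r≡ (≡.sym (m<n⇒m%n≡m (≡.subst (ℕ._< K) r≡ (m%n<n n K))))) r≢1
      by-remainder (suc (suc g)) r≡ = trans (reflexive (≡.cong D n≡′))
        (D-other (n / K) g (ℕ.≤∧≢⇒< (ℕ.s≤s⁻¹ (≡.subst (ℕ._< K) r≡ (m%n<n n K)))
          λ r≡k → r≢k (≡.trans (≡.trans r≡ r≡k) (≡.sym (m<n⇒m%n≡m (ℕ.n<1+n k))))))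
        where
        n≡′ : n ≡ suc (K ℕ.* (n / K)) ℕ.+ suc g
        n≡′ = ≡.trans n≡ (≡.trans (≡.cong₂ ℕ._+_ r≡ (ℕ.*-comm (n / K) K))
          (≡.trans (≡.cong suc (ℕ.+-comm (suc g) (K ℕ.* (n / K)))) ≡.refl))

-- From the matrix of path sums to the list of rows

module PathDeterminant {c ℓ : Level} (R : CommutativeRing c ℓ) (x y : CommutativeRing.Carrier R) (k : ℕ) where

  open CommutativeRing R hiding (zero)
  open Determinant R using (det)
  open PathSums R x y using (∑𝒫⁺)
  open RowDeterminant R
  open PolynomialRows R using (powers)
  open PathSumRecursion R x y using (∑𝒫⁺-σ)
  open HankelDeterminants R x y k using (D; base′)

  private
    tabulate-powers : ∀ n f → tabulate {n = n} (λ l j → f (toℕ l ℕ.+ j)) ≡ powers f n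
    tabulate-powers zero    f = ≡.refl
    tabulate-powers (suc n) f = ≡.cong (f ∷_) (tabulate-powers n (λ j → f (suc j)))

  det-D : ∀ n → det {n} (λ i j → ∑𝒫⁺ (suc (toℕ i ℕ.+ toℕ j)) k) ≈ D n
  det-D n = trans
    (det-Δ 0 n _ (λ l j → base′ (toℕ l ℕ.+ j)) λ i l →
      trans (∑𝒫⁺-σ (suc (toℕ i ℕ.+ toℕ l)) k) (reflexive (≡.cong base′ (ℕ.+-comm (toℕ i) (toℕ l)))))
    (reflexive (≡.cong (Δ 0 n) (tabulate-powers n base′)))

-- Cancellation of a difference of powers

module MonicCancellation {c ℓ : Level} (R : CommutativeRing c ℓ) where

  private
    module R = CommutativeRing R
    module A = CommutativeRing (Polynomial.polynomialRing R)
  open R using (_≈_; 0#; 1#)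
  open A using (_*_; _-_)
  open Polynomial R
  open import Algebra.Properties.Semiring.Exp R.semiring using () renaming (_^_ to _^ᴿ_)
  open import Algebra.Properties.Semiring.Exp A.semiring using (_^_)
  open import Algebra.Properties.Ring A.ring using ([y-z]x≈yx-zx; x[y-z]≈xy-xz; x∙y⁻¹≈ε⇒x≈y; x≈y⇒x∙y⁻¹≈ε)
  open import Relation.Binary.Reasoning.Setoid R.setoid

  private
    shifted : ℕ → Poly → ℕ → R.Carrier
    shifted zero    p i       = coeff p i
    shifted (suc d) p zero    = 0#
    shifted (suc d) p (suc i) = shifted d p i

    coeff-t* : ∀ p i → coeff (indeterminate * p) i ≈ shifted 1 p i
    coeff-t* p zero = R.trans (coeff-+ (0# ·ₚ p) _ 0) (R.trans (R.+-identityʳ _) (R.trans (coeff-· 0# p 0) (R.zeroˡ _)))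
    coeff-t* p (suc i) = begin
      coeff (indeterminate * p) (suc i)
        ≈⟨ coeff-+ (0# ·ₚ p) (0# ∷ const 1# * p) (suc i) ⟩
      coeff (0# ·ₚ p) (suc i) R.+ coeff (const 1# * p) i
        ≈⟨ R.+-cong (R.trans (coeff-· 0# p (suc i)) (R.zeroˡ _)) (coeff-≈ (A.*-identityˡ p) i) ⟩
      0# R.+ coeff p i  ≈⟨ R.+-identityˡ _ ⟩
      coeff p i         ∎

    coeff-tᵈ* : ∀ d p i → coeff (indeterminate ^ d * p) i ≈ shifted d p i
    coeff-tᵈ* zero    p i = coeff-≈ (A.*-identityˡ p) i
    coeff-tᵈ* (suc d) p zero = R.trans (coeff-≈ (A.*-assoc indeterminate (indeterminate ^ d) p) 0)
      (coeff-t* (indeterminate ^ d * p) 0)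
    coeff-tᵈ* (suc d) p (suc i) = R.trans (coeff-≈ (A.*-assoc indeterminate (indeterminate ^ d) p) (suc i))
      (R.trans (coeff-t* (indeterminate ^ d * p) (suc i)) (coeff-tᵈ* d p i))

    coeff-const* : ∀ a p i → coeff (const a * p) i ≈ a R.* coeff p i
    coeff-const* a p i = R.trans (coeff-+ (a ·ₚ p) (0# ∷ []) i)
      (R.trans (R.+-cong (coeff-· a p i) (zeros i)) (R.+-identityʳ _))
      where
      zeros : ∀ i → coeff (0# ∷ []) i ≈ 0#
      zeros zero    = R.refl
      zeros (suc i) = R.refl

    coeff-constᵈ* : ∀ a d p i → coeff (const a ^ d * p) i ≈ a ^ᴿ d R.* coeff p i
    coeff-constᵈ* a zero    p i = R.trans (coeff-≈ (A.*-identityˡ p) i) (R.sym (R.*-identityˡ _))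
    coeff-constᵈ* a (suc d) p i = begin
      coeff (const a ^ suc d * p) i         ≈⟨ coeff-≈ (A.*-assoc (const a) (const a ^ d) p) i ⟩
      coeff (const a * (const a ^ d * p)) i ≈⟨ coeff-const* a (const a ^ d * p) i ⟩
      a R.* coeff (const a ^ d * p) i       ≈⟨ R.*-congˡ (coeff-constᵈ* a d p i) ⟩
      a R.* (a ^ᴿ d R.* coeff p i)          ≈⟨ R.*-assoc _ _ _ ⟨
      a ^ᴿ suc d R.* coeff p i              ∎

    shifted-+ : ∀ d p i → shifted d p (d ℕ.+ i) ≡ coeff p i
    shifted-+ zero    p i = ≡.refl
    shifted-+ (suc d) p i = shifted-+ d p i

    coeff-large : ∀ p i → length p ℕ.≤ i → coeff p i ≈ 0#
    coeff-large []      i       _       = R.refl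
    coeff-large (a ∷ p) (suc i) (s≤s l) = coeff-large p i l

    -- (tᵈ⁺¹ − aᵈ⁺¹) p = 0 expresses every coefficient of p through one d+1
    -- places further up, and the high coefficients vanish.
    tᵈ-aᵈ-regular : ∀ a d p → (indeterminate ^ suc d - const a ^ suc d) * p ≈ₚ [] → p ≈ₚ []
    tᵈ-aᵈ-regular a d p eq = mk≈ λ i → descend (length p) i (ℕ.m≤m+n (length p) i)
      where
      step : ∀ i → coeff p i ≈ a ^ᴿ suc d R.* coeff p (suc d ℕ.+ i)
      step i = begin
        coeff p i                                           ≡⟨ shifted-+ (suc d) p i ⟨
        shifted (suc d) p (suc d ℕ.+ i)                     ≈⟨ coeff-tᵈ* (suc d) p (suc d ℕ.+ i) ⟨
        coeff (indeterminate ^ suc d * p) (suc d ℕ.+ i)     ≈⟨ coeff-≈ equal (suc d ℕ.+ i) ⟩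
        coeff (const a ^ suc d * p) (suc d ℕ.+ i)           ≈⟨ coeff-constᵈ* a (suc d) p (suc d ℕ.+ i) ⟩
        a ^ᴿ suc d R.* coeff p (suc d ℕ.+ i)                ∎
        where
        equal : indeterminate ^ suc d * p ≈ₚ const a ^ suc d * p
        equal = x∙y⁻¹≈ε⇒x≈y _ _ (A.trans (A.sym ([y-z]x≈yx-zx p (indeterminate ^ suc d) (const a ^ suc d))) eq)
      descend : ∀ r i → length p ℕ.≤ r ℕ.+ i → coeff p i ≈ 0#
      descend zero    i l≤ = coeff-large p i l≤
      descend (suc r) i l≤ = R.trans (step i) (R.trans (R.*-congˡ (descend r (suc d ℕ.+ i)
        (ℕ.≤-trans l≤ (ℕ.≤-trans (s≤s (ℕ.+-monoʳ-≤ r (ℕ.m≤n+m i d))) (ℕ.≤-reflexive (≡.sym (ℕ.+-suc r (d ℕ.+ i)))))))) (R.zeroʳ _))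

  -- In ℤ[x][y] the denominator of the quotients is monic in y, hence regular whatever the
  -- coefficient ring.
  tᵈ-aᵈ-cancelʳ : ∀ a d p q → let m = indeterminate ^ suc d - const a ^ suc d in
    p * m ≈ₚ q * m → p ≈ₚ q
  tᵈ-aᵈ-cancelʳ a d p q eq = x∙y⁻¹≈ε⇒x≈y p q (tᵈ-aᵈ-regular a d (p - q)
    (A.trans (x[y-z]≈xy-xz m p q)
      (x≈y⇒x∙y⁻¹≈ε (A.trans (A.*-comm m p) (A.trans eq (A.*-comm q m))))))
    where m = indeterminate ^ suc d - const a ^ suc d

-- Identification of `G` with the quotients

module QuotientRecursion {c ℓ : Level} (R : CommutativeRing c ℓ) (x y : CommutativeRing.Carrier R) (k : ℕ) where

  open CommutativeRing R hiding (zero)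
  open import Algebra.Properties.Semiring.Exp semiring using (_^_; ^-assocʳ)
  open import Algebra.Properties.CommutativeSemiring.Exp commutativeSemiring using (^-distrib-*)
  open import Relation.Binary.Reasoning.Setoid setoid
  open IntegerSolver R
  open HankelDeterminants R x y k using (K; G)

  private
    -- With u = xᴷ and v = yᴷ, the recursion of `G` has the characteristic roots u and v, so both uᵐ
    -- and vᵐ satisfy it.
    G-product : ∀ m → G m * (y ^ K - x ^ K) ≈ (y ^ K) ^ m - (x ^ K) ^ m
    G-product zero          = solve 1 (λ d → con (+ 0) :* d := con (+ 1) :- con (+ 1)) refl (y ^ K - x ^ K)
    G-product (suc zero)    = solve 2 (λ u v → con (+ 1) :* (v :- u) := v :* con (+ 1) :- u :* con (+ 1)) refl (x ^ K) (y ^ K)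
    G-product (suc (suc m)) = begin
      ((u + v) * G (suc m) - (x * y) ^ K * G m) * (v - u)
        ≈⟨ *-congʳ (+-congˡ (-‿cong (*-congʳ (^-distrib-* x y K)))) ⟩
      ((u + v) * G (suc m) - u * v * G m) * (v - u)
        ≈⟨ solve 4 (λ u v g h → ((u :+ v) :* g :- u :* v :* h) :* (v :- u) :=
             (u :+ v) :* (g :* (v :- u)) :- u :* v :* (h :* (v :- u))) refl u v (G (suc m)) (G m) ⟩
      (u + v) * (G (suc m) * (v - u)) - u * v * (G m * (v - u))
        ≈⟨ +-cong (*-congˡ (G-product (suc m))) (-‿cong (*-congˡ (G-product m))) ⟩
      (u + v) * (v ^ suc m - u ^ suc m) - u * v * (v ^ m - u ^ m)
        ≈⟨ solve 4 (λ u v p q → (u :+ v) :* (v :* q :- u :* p) :- u :* v :* (q :- p) :=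
             v :* (v :* q) :- u :* (u :* p)) refl u v (u ^ m) (v ^ m) ⟩
      v ^ suc (suc m) - u ^ suc (suc m) ∎
      where
      u = x ^ K
      v = y ^ K

  open Quotient R x y using (IsQ)

  G-IsQ : IsQ k G
  G-IsQ m = trans (G-product m) (+-cong (^-assocʳ y K m) (-‿cong (^-assocʳ x K m)))

-- Carries the formulas from the explicit `G` over to the given `Q`, which is known only through its
-- defining equation.
IsQ-unique : ∀ k {Q Q′} → Quotient.IsQ ℤ[x,y] x y k Q → Quotient.IsQ ℤ[x,y] x y k Q′ →
  ∀ m → Q m ℤ[x][y].≈ₚ Q′ m
IsQ-unique k {Q} {Q′} isQ isQ′ m =
  MonicCancellation.tᵈ-aᵈ-cancelʳ ℤ[x].polynomialRing ℤ[x].indeterminate k (Q m) (Q′ m)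
    (trans (isQ m) (sym (isQ′ m)))
  where open CommutativeRing ℤ[x,y] using (trans; sym)

open CommutativeRing ℤ[x,y] using (Carrier; _≈_; _+_; _*_; -_; 0#; 1#; semiring; trans)
open import Algebra.Properties.Semiring.Exp semiring using (_^_)
open Determinant ℤ[x,y] using (det)
open PathSums ℤ[x,y] x y using (∑𝒫⁺)
open Quotient ℤ[x,y] x y using (IsQ)

theorem4 : (n k : ℕ) → 1 ℕ.≤ n → (Q : ℕ → Carrier) → IsQ k Q →
    let D = det {n} (λ i j → ∑𝒫⁺ (suc (toℕ i ℕ.+ toℕ j)) k)
        K = suc k
    in
    ((n₁ : ℕ) → n ≡ K ℕ.* n₁ →
      D ≈ (- 1#) ^ (n₁ ℕ.* (K C 2))
          * (x * y) ^ (K ℕ.^ 2 ℕ.* (suc n₁ C 2) ℕ.∸ n)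
          * (Q (suc n₁) + (- 1#) ^ k * Q n₁))
    ×
    (1 ℕ.≤ k → (n₁ : ℕ) → n ≡ K ℕ.* n₁ ℕ.+ 1 →
      D ≈ (- 1#) ^ (n₁ ℕ.* (K C 2))
          * (x * y) ^ (K ℕ.^ 2 ℕ.* (suc n₁ C 2))
          * (1# + x) * (1# + y) * Q (suc n₁))
    ×
    (2 ℕ.≤ k → (n₁ : ℕ) → n ≡ K ℕ.* n₁ ℕ.+ k →
      D ≈ (- 1#) ^ (suc n₁ ℕ.* (K C 2) ℕ.+ k)
          * (x * y) ^ (K ℕ.^ 2 ℕ.* (suc n₁ C 2) ℕ.+ (k ℕ.^ 2 ℕ.∸ 1) ℕ.* suc n₁)
          * (1# + x) * (1# + y) * Q (suc n₁))
    ×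
    (¬ (n ≡ 0 [mod suc k ]) → ¬ (n ≡ 1 [mod suc k ]) → ¬ (n ≡ k [mod suc k ]) →
      D ≈ 0#)
theorem4 n k 1≤n Q isQ =
  (λ n₁ n≡ → trans det≈D (D-case₀ Q G≈Q n 1≤n n₁ n≡)) ,
  (λ 1≤k n₁ n≡ → trans det≈D (D-case₁ Q G≈Q n 1≤k n₁ n≡)) ,
  (λ { (s≤s _) n₁ n≡ → trans det≈D (D-caseₖ Q G≈Q n _ ≡.refl n₁ n≡) }) ,
  (λ r≢0 r≢1 r≢k → trans det≈D (D-case-other Q G≈Q n r≢0 r≢1 r≢k))
  where
  open HankelDeterminants ℤ[x,y] x y k using (D-case₀; D-case₁; D-caseₖ; D-case-other)
  G≈Q = IsQ-unique k (QuotientRecursion.G-IsQ ℤ[x,y] x y k) isQ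
  det≈D = PathDeterminant.det-D ℤ[x,y] x y k n
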